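{- Let $n\ge1$ and let $T$ be the $2n\times 2$ matrix with rows $[x_i,y_i]$, $i=1,\dots,2n$. Let $\Delta_i=x_{2i-1}y_{2i}+x_{2i}y_{2i-1}$ and $S_i=(x_{2i-1}y_{2i-1}x_{2i}y_{2i})^{1/2}$ for $i=1,\dots,n$. Then $$ M(AD_{n};\mathrm{y}_T)=M(AD_{n-1};\mathrm{y}_{\mathrm{r}(T)})\prod_{i=1}^n\frac{\Delta_i}{S_i} $$ for $n$ even, and $$ M(AD_{n};\mathrm{y}_T)=M(AD_{n-1};\mathrm{y}_{\mathrm{r}(T)})\prod_{i=1}^n\Delta_i $$ for $n$ odd.
   Context: For $n\ge0$, the Aztec diamond graph $AD_n$ has vertices $u_{i,j}$ ($0\le i\le n$, $1\le j\le n$) and $v_{i,j}$ ($1\le i\le n$, $0\le j\le n$), and $4n^2$ edges $\epsilon_{r,s}$, $1\le r,s\le 2n$ (the edge centers form a $2n\times2n$ array), where for $1\le i,j\le n$: $\epsilon_{2i-1,2j-1}=u_{i-1,j}v_{i,j-1}$, $\epsilon_{2i-1,2j}=u_{i-1,j}v_{i,j}$, $\epsilon_{2i,2j-1}=u_{i,j}v_{i,j-1}$, $\epsilon_{2i,2j}=u_{i,j}v_{i,j}$. $AD_0$ is the empty graph. The weight of a perfect matching is the product of the weights of its edges, and $M(G;\mathrm{wt})$ is the sum of the weights of all perfect matchings of $G$ (equal to $1$ for the empty graph). For a $2n\times2$ matrix $T$ with rows $[x_i,y_i]$ (with invertible entries), $\mathrm{y}_T$ is the weight on $AD_n$ assigning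 to $\epsilon_{r,s}$ the value $x_r$, $y_r$, $1/x_r$, $1/y_r$ according as $s\equiv 1,2,3,0 \pmod 4$. The operator $\mathrm{r}$ sends $T$ to the $(2n-2)\times 2$ matrix $\mathrm{r}(T)$ whose row $2k-1$ is $[\,x_{2k-1}/S_k,\ S_k/y_{2k-1}\,]$ and whose row $2k$ is $[\,x_{2k+2}/S_{k+1},\ S_{k+1}/y_{2k+2}\,]$, for $k=1,\dots,n-1$, with $S_i=(x_{2i-1}y_{2i-1}x_{2i}y_{2i})^{1/2}$. The $x_i,y_i$ are independent indeterminates; square roots are taken in the field $\mathbb Q(\xi_1,\eta_1,\dots,\xi_{2n},\eta_{2n})$ with $x_i=\xi_i^2$, $y_i=\eta_i^2$, so that $S_i=\xi_{2i-1}\eta_{2i-1}\xi_{2i}\eta_{2i}$. -}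

module Defs where

open import Algebra.Bundles using (CommutativeRing)
open import Algebra.Definitions using (Invertible)
import Algebra.Properties.CommutativeSemigroup as CommutativeSemigroupProperties
import Algebra.Properties.CommutativeMonoid.Sum as FiniteSum
open import Data.Fin.Base using (Fin; toℕ; inject₁; suc; combine; remQuot)
open import Data.Fin.Patterns using (0F; 1F; 2F; 3F)
import Data.Fin.Properties as Fin
open import Data.List.Base
  using (List; []; _∷_; [_]; _++_; map; foldr; filter; length; allFin; cartesianProduct)
open import Data.List.Membership.Propositional using (_∈_)
open import Data.List.Membership.Propositional.Properties
  using (∈-allFin; ∈-cartesianProduct⁺; ∈-map⁺; ∈-map⁻; ∈-++⁺ˡ; ∈-++⁺ʳ)
open import Data.List.Relation.Unary.All as All using (All)
open import Data.List.Relation.Unary.Unique.Propositional using (Unique)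
import Data.List.Relation.Unary.Unique.Propositional.Properties as Unique
open import Data.Nat.Base using (ℕ; suc; _*_)
open import Data.Nat.DivMod using (_mod_)
import Data.Nat.Properties as ℕ
open import Data.Product.Base using (Σ; _×_; _,_; proj₁; proj₂)
import Data.Product.Properties as Product
open import Data.Sum.Base using (_⊎_; inj₁; inj₂)
import Data.Sum.Properties as Sum
open import Level using (_⊔_)
open import Relation.Binary.Definitions using (DecidableEquality)
open import Relation.Binary.PropositionalEquality using (_≡_; refl)
open import Relation.Nullary using (Dec; ¬_)
open import Relation.Nullary.Decidable using (_⊎-dec_)

record Graph : Set₁ where
  field
    Vertex          : Set
    Edge            : Set
    ends            : Edge → Vertex × Vertex
    _≟_             : DecidableEquality Vertex
    vertices        : List Vertex
    edges           : List Edge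
    vertices-all    : ∀ v → v ∈ vertices
    edges-all       : ∀ e → e ∈ edges
    vertices-unique : Unique vertices
    edges-unique    : Unique edges

  Incident : Vertex → Edge → Set
  Incident v e = (v ≡ proj₁ (ends e)) ⊎ (v ≡ proj₂ (ends e))

  incident? : ∀ v e → Dec (Incident v e)
  incident? v e = (v ≟ proj₁ (ends e)) ⊎-dec (v ≟ proj₂ (ends e))

  IsPerfectMatching : List Edge → Set
  IsPerfectMatching es = All (λ v → length (filter (incident? v) es) ≡ 1) vertices

  isPerfectMatching? : ∀ es → Dec (IsPerfectMatching es)
  isPerfectMatching? es =
    All.all? (λ v → length (filter (incident? v) es) ℕ.≟ 1) vertices

-- All sublists; on a list without repetitions, each subset occurs exactly once.
subsets : ∀ {a} {A : Set a} → List A → List (List A)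
subsets []       = [ [] ]
subsets (x ∷ xs) = map (x ∷_) (subsets xs) ++ subsets xs

perfectMatchings : (G : Graph) → List (List (Graph.Edge G))
perfectMatchings G = filter isPerfectMatching? (subsets edges)
  where open Graph G

-- All `Fin` indices are shifted so as to start at 0, except those which
-- already start at 0 in the definition of AD_n.  Thus `u i j` stands for
-- u_{i,j+1} and `v i j` stands for v_{i+1,j}.

AztecVertex : ℕ → Set
AztecVertex n = (Fin (suc n) × Fin n) ⊎ (Fin n × Fin (suc n))

pattern u i j = inj₁ (i , j)
pattern v i j = inj₂ (i , j)

-- The pair (r , s) stands for ε_{r+1,s+1}.  The bound is written n * 2 to fit
-- `remQuot` and `combine`: toℕ (combine i a) = 2 * toℕ i + toℕ a.
AztecEdge : ℕ → Set
AztecEdge n = Fin (n * 2) × Fin (n * 2)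

-- With i, j counted from 1, the four clauses give the ends of
-- ε_{2i-1,2j-1}, ε_{2i-1,2j}, ε_{2i,2j-1} and ε_{2i,2j}.
aztecEnds : ∀ n → AztecEdge n → AztecVertex n × AztecVertex n
aztecEnds n (r , s) with remQuot {n} 2 r | remQuot {n} 2 s
... | i , 0F | j , 0F = u (inject₁ i) j , v i (inject₁ j)
... | i , 0F | j , 1F = u (inject₁ i) j , v i (suc j)
... | i , 1F | j , 0F = u (suc i) j     , v i (inject₁ j)
... | i , 1F | j , 1F = u (suc i) j     , v i (suc j)

AD : ℕ → Graph
AD n = record
  { Vertex          = AztecVertex n
  ; Edge            = AztecEdge n
  ; ends            = aztecEnds n
  ; _≟_             = Sum.≡-dec (Product.≡-dec Fin._≟_ Fin._≟_)
                                (Product.≡-dec Fin._≟_ Fin._≟_)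
  ; vertices        = map inj₁ us ++ map inj₂ vs
  ; edges           = cartesianProduct (allFin (n * 2)) (allFin (n * 2))
  ; vertices-all    = λ where
      (u i j) → ∈-++⁺ˡ (∈-map⁺ inj₁ (∈-cartesianProduct⁺ (∈-allFin i) (∈-allFin j)))
      (v i j) → ∈-++⁺ʳ (map inj₁ us)
                  (∈-map⁺ inj₂ (∈-cartesianProduct⁺ (∈-allFin i) (∈-allFin j)))
  ; edges-all       = λ (r , s) → ∈-cartesianProduct⁺ (∈-allFin r) (∈-allFin s)
  ; vertices-unique = Unique.++⁺
      (Unique.map⁺ Sum.inj₁-injective
        (Unique.cartesianProduct⁺ (Unique.allFin⁺ (suc n)) (Unique.allFin⁺ n)))
      (Unique.map⁺ Sum.inj₂-injective
        (Unique.cartesianProduct⁺ (Unique.allFin⁺ n) (Unique.allFin⁺ (suc n))))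
      disjoint
  ; edges-unique    =
      Unique.cartesianProduct⁺ (Unique.allFin⁺ (n * 2)) (Unique.allFin⁺ (n * 2))
  }
  where
  us = cartesianProduct (allFin (suc n)) (allFin n)
  vs = cartesianProduct (allFin n) (allFin (suc n))

  disjoint : ∀ {w : AztecVertex n} → ¬ (w ∈ map inj₁ us × w ∈ map inj₂ vs)
  disjoint (p , q) with ∈-map⁻ inj₁ p | ∈-map⁻ inj₂ q
  ... | _ , _ , refl | _ , _ , ()

-- Weights are units of an arbitrary commutative ring R.  An identity in
-- independent indeterminates ξ_i, η_i is stated for all units ξ_i, η_i of all R;
-- the indeterminates themselves are the case R = ℚ(ξ_1, η_1, …, ξ_{2n}, η_{2n}).
module Weights {c ℓ} (R : CommutativeRing c ℓ) where

  open CommutativeRing R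
    renaming (_+_ to _+ᴿ_; _*_ to _*ᴿ_; refl to ≈-refl)
  open CommutativeSemigroupProperties *-commutativeSemigroup using (interchange)
  open FiniteSum *-commutativeMonoid public using () renaming (sum to ∏)

  -- Invertible elements together with their inverses.
  Unit : Set (c ⊔ ℓ)
  Unit = Σ Carrier (Invertible _≈_ 1# _*ᴿ_)

  ⟦_⟧ : Unit → Carrier
  ⟦_⟧ = proj₁

  infixl 7 _·_ _÷_
  infix 8 _⁻¹

  _⁻¹ : Unit → Unit
  (a , a′ , p , q) ⁻¹ = a′ , a , q , p

  _·_ : Unit → Unit → Unit
  (a , a′ , p , q) · (b , b′ , p′ , q′) =
    a *ᴿ b , a′ *ᴿ b′ ,
    trans (interchange a′ b′ a b) (trans (*-cong p p′) (*-identityˡ 1#)) ,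
    trans (interchange a b a′ b′) (trans (*-cong q q′) (*-identityˡ 1#))

  _÷_ : Unit → Unit → Unit
  a ÷ b = a · b ⁻¹

  -- The sum is 1 for AD 0, whose only set of edges is empty.
  M : (G : Graph) → (Graph.Edge G → Unit) → Carrier
  M G wt = foldr _+ᴿ_ 0# (map weight (perfectMatchings G))
    where
    weight : List (Graph.Edge G) → Carrier
    weight es = foldr _*ᴿ_ 1# (map (λ e → ⟦ wt e ⟧) es)

  -- 2n × 2 matrices; the row with index i is the pair (x_{i+1} , y_{i+1}).
  Matrix : ℕ → Set (c ⊔ ℓ)
  Matrix n = Fin (n * 2) → Unit × Unit

  -- The rows 2i-1 and 2i, for i counted from 1.
  odd even : ∀ {n} → Fin n → Fin (n * 2)
  odd  i = combine i 0F
  even i = combine i 1F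

  x y : ∀ {m} → (Fin m → Unit × Unit) → Fin m → Unit
  x T i = proj₁ (T i)
  y T i = proj₂ (T i)

  -- `suc (toℕ s)` is the column number s counted from 1.
  yWeight : ∀ n → Matrix n → Graph.Edge (AD n) → Unit
  yWeight n T (r , s) with suc (toℕ s) mod 4
  ... | 1F = x T r
  ... | 2F = y T r
  ... | 3F = x T r ⁻¹
  ... | 0F = y T r ⁻¹

  Δ : ∀ n → Matrix n → Fin n → Carrier
  Δ n T i = ⟦ x T (odd i) ⟧ *ᴿ ⟦ y T (even i) ⟧ +ᴿ ⟦ x T (even i) ⟧ *ᴿ ⟦ y T (odd i) ⟧

  -- The matrix r(T) for T with n+1 pairs of rows; S is the family of the
  -- chosen square roots S_i.
  r : ∀ n → (Fin (suc n) → Unit) → Matrix (suc n) → Matrix n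
  r n S T i with remQuot {n} 2 i
  ... | k , 0F = x T (odd k₀) ÷ S k₀ , S k₀ ÷ y T (odd k₀)
    where k₀ = inject₁ k
  ... | k , 1F = x T (even k₁) ÷ S k₁ , S k₁ ÷ y T (even k₁)
    where k₁ = suc k

  squares : ∀ n → (ξ η : Fin (n * 2) → Unit) → Matrix n
  squares n ξ η i = ξ i · ξ i , η i · η i

  -- S_i = ξ_{2i-1} η_{2i-1} ξ_{2i} η_{2i}, the square root of
  -- x_{2i-1} y_{2i-1} x_{2i} y_{2i} for T = squares n ξ η.
  roots : ∀ n → (ξ η : Fin (n * 2) → Unit) → Fin n → Unit
  roots n ξ η i = ξ (odd i) · η (odd i) · ξ (even i) · η (even i)

{-# OPTIONS --safe #-}

-- Partition the edges of AD_n into n² cells, the 4-cycles with edges ε_{2i-1,2j-1},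
-- ε_{2i-1,2j}, ε_{2i,2j-1}, ε_{2i,2j}.  Every inner vertex lies in two cells, so a
-- matching determines a bit at each vertex, the cell of its edge, and M becomes a
-- sum over these bits of products of local factors of the cells (a six-vertex
-- partition function).  AD_{n-1} is AD_n without its boundary vertices, so that it
-- has a sum of the same kind.  Complementing its bits, the local factors of a cell
-- for the two graphs agree up to factors Δ_i and S_i (urban renewal).  No division
-- by Δ_i is needed: the discrepancy is a gauge factor attached to the bits at the
-- left and right vertices of the cell, which telescopes along each row of cells and
-- leaves Δ_i / S_i or Δ_i at its end, depending on the parity of n.

module Submission where

open import Defs
open import Algebra.Bundles using (CommutativeMonoid; CommutativeRing)
import Algebra.Properties.CommutativeMonoid.Sum as FiniteSum
import Algebra.Properties.CommutativeSemigroup as CommutativeSemigroupProperties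
open import Data.Bool.Base using (Bool; true; false; if_then_else_; _∧_; _xor_; not)
import Data.Bool.Properties as Bool
open import Data.Fin.Base using (Fin; zero; suc; inject₁; fromℕ; toℕ; combine; remQuot)
open import Data.Fin.Patterns using (0F; 1F; 2F; 3F)
import Data.Fin.Properties as Fin
open import Data.List.Base
  using (List; []; _∷_; [_]; _++_; map; foldr; filter; filterᵇ; length; tabulate; allFin;
         cartesianProduct; cartesianProductWith)
open import Data.List.Membership.Propositional using (_∈_)
open import Data.List.Membership.Propositional.Properties
  using (∈-allFin; ∈-cartesianProduct⁺; ∈-filter⁺; ∈-filter⁻; ∈-map⁺; ∈-map⁻; ∈-++⁺ˡ; ∈-++⁺ʳ; ∈-∃++)
open import Data.List.Membership.Propositional.Properties.WithK using (unique∧set⇒bag)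
open import Data.List.Properties using (map-∘; filter-accept; filter-reject; ++-identityʳ)
open import Data.List.Relation.Binary.BagAndSetEquality using (∼bag⇒↭)
open import Data.List.Relation.Binary.Permutation.Propositional as ↭ using (_↭_)
import Data.List.Relation.Binary.Permutation.Propositional.Properties as ↭
open import Data.List.Relation.Unary.All as All using (All; []; _∷_)
import Data.List.Relation.Unary.All.Properties as All
open import Data.List.Relation.Unary.AllPairs using ([]; _∷_)
open import Data.List.Relation.Unary.Unique.Propositional using (Unique)
import Data.List.Relation.Unary.Unique.Propositional.Properties as Unique
open import Data.Nat.Base as ℕ using (ℕ; zero; suc; _≡ᵇ_; parity)
open import Data.Nat.DivMod using (_mod_)
open import Data.Nat.Divisibility using (_∣_; _∤_; divides; ∣-refl; ∣m∣n⇒∣m+n)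
import Data.Nat.Properties as ℕ
open import Data.Parity.Base using (Parity; 0ℙ; 1ℙ) renaming (_⁻¹ to flip)
open import Data.Product.Base using (∃; _×_; _,_; proj₁; proj₂)
import Data.Product.Properties as Productₚ
open import Data.Sum.Base using (_⊎_; inj₁; inj₂)
import Data.Sum.Properties as Sumₚ
open import Data.Vec.Base using (Vec; []; _∷_; lookup)
open import Function.Base using (_∘_; case_of_; const; id)
open import Function.Bundles using (mk⇔)
open import Level using (Level)
open import Relation.Binary.Definitions using (DecidableEquality)
open import Relation.Binary.PropositionalEquality as ≡ using (_≡_; _≢_; cong; cong₂; subst)
import Relation.Binary.Reasoning.Setoid as SetoidReasoning
open import Relation.Nullary using (Dec; does; yes; no; ¬_; contradiction)
open import Relation.Unary using (Pred; Decidable)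

-- The scalar σ by which the weights of a cell are multiplied when each edge is replaced by the
-- opposite one is not free. Comparing the nonzero configurations of a cell makes the ratio of the
-- gauge at bit `false` to the gauge at bit `true` equal to σ·det at both sides of the cell, where
-- det is the sum over the two matchings of the cell. Telescoping therefore needs σ·det to be
-- constant along a row. In the first, third, ... column of cells det is Δ_i; in the others, whose
-- entries are inverted, it is Δ_i / S_i². So σ alternates between 1 / S_i and S_i, with common
-- ratio Δ_i / S_i. This is the origin of the scalings x / S and S / y in r(T), and of the square
-- roots. Each cell also multiplies the gauge at `true` by 1 / σ, so that this value runs 1, S_i, 1,
-- ... along the row, which is why the parity of n matters.

private variable
  a b : Level
  A B C : Set a
  m n : ℕ

-- Lists, sublists and permutations

vectors : List A → ∀ n → List (Vec A n)
vectors xs zero    = [ [] ]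
vectors xs (suc n) = cartesianProductWith _∷_ xs (vectors xs n)

subsets-All : ∀ {p} {P : A → Set p} {xs} → All P xs → All (All P) (subsets xs)
subsets-All []         = [] ∷ []
subsets-All (px ∷ pxs) =
  All.++⁺ (All.map⁺ (All.map (px ∷_) (subsets-All pxs))) (subsets-All pxs)

-- `N b` serves as the negation of membership in the image of f.
↭-image : {f : A → B} {xs : List A} {ys : List B} {N : B → Set} →
  (∀ {x x′} → f x ≡ f x′ → x ≡ x′) →
  (∀ y → (∃ λ x → y ≡ f x) ⊎ N y) → (∀ x → ¬ N (f x)) →
  (∀ x → x ∈ xs) → Unique xs → (∀ y → y ∈ ys) → Unique ys →
  ∃ λ rest → ys ↭ rest ++ map f xs × All N rest
↭-image {f = f} {xs} {ys} {N} inj split N-im all-xs uniq-xs all-ys uniq-ys =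
  rest , ∼bag⇒↭ (unique∧set⇒bag uniq-ys
    (Unique.++⁺ (Unique.filter⁺ N? uniq-ys) (Unique.map⁺ inj uniq-xs) disjoint)
    (λ {y} → mk⇔ (λ _ → member y) (λ _ → all-ys y))) , All.all-filter N? ys
  where
  N? : ∀ y → Dec (N y)
  N? y with split y
  ... | inj₁ (x , ≡.refl) = no (N-im x)
  ... | inj₂ ny           = yes ny

  rest = filter N? ys

  disjoint : ∀ {y} → ¬ (y ∈ rest × y ∈ map f xs)
  disjoint (p , q) with ∈-map⁻ f q
  ... | x , _ , ≡.refl = N-im x (proj₂ (∈-filter⁻ N? {xs = ys} p))

  member : ∀ y → y ∈ rest ++ map f xs
  member y with split y
  ... | inj₁ (x , ≡.refl) = ∈-++⁺ʳ rest (∈-map⁺ f (all-xs x))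
  ... | inj₂ ny           = ∈-++⁺ˡ (∈-filter⁺ N? (all-ys y) ny)

-- Finite sums and products over lists and over their sublists

module BigOperator {c ℓ} (CM : CommutativeMonoid c ℓ) where

  open CommutativeMonoid CM
  open CommutativeSemigroupProperties commutativeSemigroup using (interchange; x∙yz≈y∙xz)
  open FiniteSum CM using (sum)
  open SetoidReasoning setoid

  fold : List A → (A → Carrier) → Carrier
  fold xs f = foldr _∙_ ε (map f xs)

  fold-cong-All : ∀ {xs : List A} {f g} → All (λ x → f x ≈ g x) xs → fold xs f ≈ fold xs g
  fold-cong-All []       = refl
  fold-cong-All (p ∷ ps) = ∙-cong p (fold-cong-All ps)

  fold-cong : ∀ (xs : List A) {f g} → (∀ x → f x ≈ g x) → fold xs f ≈ fold xs g
  fold-cong xs f≈g = fold-cong-All (All.universal f≈g xs)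

  fold-ε : ∀ {xs : List A} {f} → All (λ x → f x ≈ ε) xs → fold xs f ≈ ε
  fold-ε []       = refl
  fold-ε (p ∷ ps) = trans (∙-cong p (fold-ε ps)) (identityˡ ε)

  fold-++ : ∀ (xs ys : List A) f → fold (xs ++ ys) f ≈ fold xs f ∙ fold ys f
  fold-++ []       ys f = sym (identityˡ _)
  fold-++ (x ∷ xs) ys f = trans (∙-congˡ (fold-++ xs ys f)) (sym (assoc _ _ _))

  fold-map : ∀ (g : A → B) xs f → fold (map g xs) f ≡ fold xs (f ∘ g)
  fold-map g xs f = cong (foldr _∙_ ε) (≡.sym (map-∘ xs))

  fold-∙ : ∀ (xs : List A) f g → fold xs (λ x → f x ∙ g x) ≈ fold xs f ∙ fold xs g
  fold-∙ []       f g = sym (identityˡ ε)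
  fold-∙ (x ∷ xs) f g = trans (∙-congˡ (fold-∙ xs f g)) (interchange _ _ _ _)

  fold-comm : ∀ (xs : List A) (ys : List B) (f : A → B → Carrier) →
    fold xs (λ x → fold ys (f x)) ≈ fold ys (λ y → fold xs (λ x → f x y))
  fold-comm []       ys f = sym (fold-ε (All.universal (λ _ → refl) ys))
  fold-comm (x ∷ xs) ys f = trans (∙-congˡ (fold-comm xs ys f)) (sym (fold-∙ ys _ _))

  fold-cartesianProductWith : ∀ (g : A → B → C) xs ys f →
    fold (cartesianProductWith g xs ys) f ≈ fold xs (λ x → fold ys (λ y → f (g x y)))
  fold-cartesianProductWith g []       ys f = refl
  fold-cartesianProductWith g (x ∷ xs) ys f = begin
    fold (map (g x) ys ++ cartesianProductWith g xs ys) f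
      ≈⟨ fold-++ (map (g x) ys) _ f ⟩
    fold (map (g x) ys) f ∙ fold (cartesianProductWith g xs ys) f
      ≈⟨ ∙-cong (reflexive (fold-map (g x) ys f)) (fold-cartesianProductWith g xs ys f) ⟩
    fold (x ∷ xs) (λ x → fold ys (λ y → f (g x y))) ∎

  fold-↭ : ∀ {xs ys : List A} f → xs ↭ ys → fold xs f ≈ fold ys f
  fold-↭ f ↭.refl         = refl
  fold-↭ f (↭.prep x p)   = ∙-congˡ (fold-↭ f p)
  fold-↭ f (↭.swap x y p) = trans (∙-congˡ (∙-congˡ (fold-↭ f p))) (x∙yz≈y∙xz _ _ _)
  fold-↭ f (↭.trans p q)  = trans (fold-↭ f p) (fold-↭ f q)

  fold-tabulate : ∀ {n} (g : Fin n → A) f → fold (tabulate g) f ≡ sum (f ∘ g)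
  fold-tabulate {n = zero}  g f = ≡.refl
  fold-tabulate {n = suc n} g f = cong (f (g zero) ∙_) (fold-tabulate (g ∘ suc) f)

  fold-subsets-∷ : ∀ (x : A) xs f →
    fold (subsets (x ∷ xs)) f ≈ fold (subsets xs) (f ∘ (x ∷_)) ∙ fold (subsets xs) f
  fold-subsets-∷ x xs f =
    trans (fold-++ (map (x ∷_) (subsets xs)) _ f)
          (∙-congʳ (reflexive (fold-map (x ∷_) (subsets xs) f)))

  fold-subsets-map : ∀ (g : A → B) xs f →
    fold (subsets (map g xs)) f ≈ fold (subsets xs) (f ∘ map g)
  fold-subsets-map g []       f = refl
  fold-subsets-map g (x ∷ xs) f = begin
    fold (subsets (g x ∷ map g xs)) f
      ≈⟨ fold-subsets-∷ (g x) (map g xs) f ⟩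
    fold (subsets (map g xs)) (f ∘ (g x ∷_)) ∙ fold (subsets (map g xs)) f
      ≈⟨ ∙-cong (fold-subsets-map g xs _) (fold-subsets-map g xs f) ⟩
    fold (subsets xs) (f ∘ map g ∘ (x ∷_)) ∙ fold (subsets xs) (f ∘ map g)
      ≈⟨ fold-subsets-∷ x xs (f ∘ map g) ⟨
    fold (subsets (x ∷ xs)) (f ∘ map g) ∎

  fold-subsets-++ : ∀ (xs ys : List A) f →
    fold (subsets (xs ++ ys)) f ≈
    fold (subsets xs) (λ as → fold (subsets ys) (λ bs → f (as ++ bs)))
  fold-subsets-++ []       ys f = sym (identityʳ _)
  fold-subsets-++ (x ∷ xs) ys f = begin
    fold (subsets (x ∷ xs ++ ys)) f
      ≈⟨ fold-subsets-∷ x (xs ++ ys) f ⟩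
    fold (subsets (xs ++ ys)) (f ∘ (x ∷_)) ∙ fold (subsets (xs ++ ys)) f
      ≈⟨ ∙-cong (fold-subsets-++ xs ys _) (fold-subsets-++ xs ys f) ⟩
    _ ≈⟨ fold-subsets-∷ x xs _ ⟨
    fold (subsets (x ∷ xs)) (λ as → fold (subsets ys) (λ bs → f (as ++ bs))) ∎

  -- Permuting the list also permutes the entries of its sublists, so the summand has to be
  -- invariant under `↭`. For a transposition the sublists fall into four classes by the presence of
  -- `x` and `y`, and the two classes containing just one of them trade places.
  fold-subsets-↭ : ∀ {xs ys : List A} f → (∀ {as bs} → as ↭ bs → f as ≈ f bs) →
    xs ↭ ys → fold (subsets xs) f ≈ fold (subsets ys) f
  fold-subsets-↭ f inv ↭.refl = refl
  fold-subsets-↭ f inv (↭.prep {xs} {ys} x p) = begin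
    fold (subsets (x ∷ xs)) f
      ≈⟨ fold-subsets-∷ x xs f ⟩
    fold (subsets xs) (f ∘ (x ∷_)) ∙ fold (subsets xs) f
      ≈⟨ ∙-cong (fold-subsets-↭ _ (inv ∘ ↭.prep x) p) (fold-subsets-↭ f inv p) ⟩
    fold (subsets ys) (f ∘ (x ∷_)) ∙ fold (subsets ys) f
      ≈⟨ fold-subsets-∷ x ys f ⟨
    fold (subsets (x ∷ ys)) f ∎
  fold-subsets-↭ f inv (↭.swap {xs} {ys} x y p) = begin
    fold (subsets (x ∷ y ∷ xs)) f
      ≈⟨ twice x y xs ⟩
    (fold (subsets xs) (f ∘ (x ∷_) ∘ (y ∷_)) ∙ fold (subsets xs) (f ∘ (x ∷_))) ∙
    (fold (subsets xs) (f ∘ (y ∷_)) ∙ fold (subsets xs) f)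
      ≈⟨ interchange _ _ _ _ ⟩
    (fold (subsets xs) (f ∘ (x ∷_) ∘ (y ∷_)) ∙ fold (subsets xs) (f ∘ (y ∷_))) ∙
    (fold (subsets xs) (f ∘ (x ∷_)) ∙ fold (subsets xs) f)
      ≈⟨ ∙-cong (∙-cong
           (trans (fold-cong (subsets xs) (λ _ → inv (↭.swap x y ↭.refl)))
                  (fold-subsets-↭ _ (inv ∘ ↭.prep y ∘ ↭.prep x) p))
           (fold-subsets-↭ _ (inv ∘ ↭.prep y) p))
         (∙-cong (fold-subsets-↭ _ (inv ∘ ↭.prep x) p) (fold-subsets-↭ f inv p)) ⟩
    (fold (subsets ys) (f ∘ (y ∷_) ∘ (x ∷_)) ∙ fold (subsets ys) (f ∘ (y ∷_))) ∙
    (fold (subsets ys) (f ∘ (x ∷_)) ∙ fold (subsets ys) f)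
      ≈⟨ twice y x ys ⟨
    fold (subsets (y ∷ x ∷ ys)) f ∎
    where
    twice : ∀ x y zs → fold (subsets (x ∷ y ∷ zs)) f ≈
      (fold (subsets zs) (f ∘ (x ∷_) ∘ (y ∷_)) ∙ fold (subsets zs) (f ∘ (x ∷_))) ∙
      (fold (subsets zs) (f ∘ (y ∷_)) ∙ fold (subsets zs) f)
    twice x y zs = trans (fold-subsets-∷ x (y ∷ zs) f)
      (∙-cong (fold-subsets-∷ y zs _) (fold-subsets-∷ y zs f))
  fold-subsets-↭ f inv (↭.trans p q) =
    trans (fold-subsets-↭ f inv p) (fold-subsets-↭ f inv q)

  fold-subsets-discard : ∀ {rest xs : List A} f →
    All (λ x → ∀ as → f (x ∷ as) ≈ ε) rest →
    fold (subsets (rest ++ xs)) f ≈ fold (subsets xs) f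
  fold-subsets-discard f [] = refl
  fold-subsets-discard {rest = x ∷ rest} {xs} f (p ∷ ps) = begin
    fold (subsets (x ∷ rest ++ xs)) f
      ≈⟨ fold-subsets-∷ x (rest ++ xs) f ⟩
    fold (subsets (rest ++ xs)) (f ∘ (x ∷_)) ∙ fold (subsets (rest ++ xs)) f
      ≈⟨ ∙-cong (fold-ε (All.universal p (subsets (rest ++ xs)))) (fold-subsets-discard f ps) ⟩
    ε ∙ fold (subsets xs) f
      ≈⟨ identityˡ _ ⟩
    fold (subsets xs) f ∎

-- Embeddings of graphs

degree : (G : Graph) → Graph.Vertex G → List (Graph.Edge G) → ℕ
degree G p es = length (filter (Graph.incident? G p) es)

degree-∷ : ∀ G p e es → Graph.Incident G p e → degree G p (e ∷ es) ≡ suc (degree G p es)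
degree-∷ G p e es inc = cong length (filter-accept (Graph.incident? G p) inc)

degree-∷-¬ : ∀ G p e es → ¬ Graph.Incident G p e → degree G p (e ∷ es) ≡ degree G p es
degree-∷-¬ G p e es ¬inc = cong length (filter-reject (Graph.incident? G p) ¬inc)

1≢0 : ∀ {k} → k ≡ 1 → ¬ k ≡ 0
1≢0 ≡.refl ()

-- An embedding of G onto an induced subgraph of H, all vertices of H outside
-- its image being marked by an external degree 1.
record Embedding (G H : Graph) (ext : Graph.Vertex H → ℕ) : Set where
  private
    module G = Graph G
    module H = Graph H
  field
    onVertex         : G.Vertex → H.Vertex
    onEdge           : G.Edge → H.Edge
    vertex-injective : ∀ {p p′} → onVertex p ≡ onVertex p′ → p ≡ p′
    edge-injective   : ∀ {e e′} → onEdge e ≡ onEdge e′ → e ≡ e′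
    incident⁺        : ∀ {p e} → G.Incident p e → H.Incident (onVertex p) (onEdge e)
    incident⁻        : ∀ {q e} → H.Incident q (onEdge e) → ∃ λ p → q ≡ onVertex p × G.Incident p e
    ext-inner        : ∀ p → ext (onVertex p) ≡ 0
    ext-outer        : ∀ q → (∃ λ p → q ≡ onVertex p) ⊎ ext q ≡ 1
    edge-outer       : ∀ x → (∃ λ e → x ≡ onEdge e) ⊎ (∃ λ q → H.Incident q x × ext q ≡ 1)

  ext-ends : ∀ {q e} → H.Incident q (onEdge e) → ext q ≡ 0
  ext-ends inc with incident⁻ inc
  ... | p , ≡.refl , _ = ext-inner p

  degree-inner : ∀ p es → degree H (onVertex p) (map onEdge es) ≡ degree G p es
  degree-inner p []       = ≡.refl
  degree-inner p (e ∷ es) = case G.incident? p e of λ where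
      (yes inc) → ≡.trans (degree-∷ H (onVertex p) (onEdge e) _ (incident⁺ inc))
        (≡.trans (cong suc (degree-inner p es)) (≡.sym (degree-∷ G p e es inc)))
      (no ¬inc) → ≡.trans (degree-∷-¬ H (onVertex p) (onEdge e) _ (¬incident ¬inc))
        (≡.trans (degree-inner p es) (≡.sym (degree-∷-¬ G p e es ¬inc)))
    where
    ¬incident : ¬ G.Incident p e → ¬ H.Incident (onVertex p) (onEdge e)
    ¬incident ¬inc inc with incident⁻ inc
    ... | p′ , eq , inc′ = ¬inc (subst (λ q → G.Incident q e) (≡.sym (vertex-injective eq)) inc′)

  degree-outer : ∀ q → ext q ≡ 1 → ∀ es → degree H q (map onEdge es) ≡ 0
  degree-outer q ext≡1 []       = ≡.refl
  degree-outer q ext≡1 (e ∷ es) = ≡.trans (degree-∷-¬ H q (onEdge e) _ ¬inc) (degree-outer q ext≡1 es)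
    where
    ¬inc : ¬ H.Incident q (onEdge e)
    ¬inc inc = 1≢0 ext≡1 (ext-ends inc)

-- The decomposition of an Aztec diamond into cells

mark : Bool → ℕ
mark b = if b then 1 else 0

Cell : ℕ → Set
Cell n = Fin n × Fin n

Corner : Set
Corner = Fin 2 × Fin 2

cells : ∀ n → List (Cell n)
cells n = cartesianProduct (allFin n) (allFin n)

corners : List Corner
corners = cartesianProduct (allFin 2) (allFin 2)

shift : Fin n → Fin 2 → Fin (suc n)
shift i 0F = inject₁ i
shift i 1F = suc i

-- AD n with its edges grouped into 4-cycles: the edges of the cell (i , j) join
-- the upper or lower vertex u to the left or right vertex v, as chosen by the corner.
cellGraph : ℕ → Graph
cellGraph n = record (AD n)
  { Edge         = Cell n × Corner
  ; ends         = λ ((i , j) , (a , b)) → u (shift i a) j , v i (shift j b)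
  ; edges        = cartesianProduct (cells n) corners
  ; edges-all    = λ ((i , j) , (a , b)) → ∈-cartesianProduct⁺
      (∈-cartesianProduct⁺ (∈-allFin i) (∈-allFin j))
      (∈-cartesianProduct⁺ (∈-allFin a) (∈-allFin b))
  ; edges-unique = Unique.cartesianProduct⁺ cells-unique
      (Unique.cartesianProduct⁺ (Unique.allFin⁺ 2) (Unique.allFin⁺ 2))
  }
  where
  cells-unique = Unique.cartesianProduct⁺ (Unique.allFin⁺ n) (Unique.allFin⁺ n)

-- The degrees of the n+1 vertices on a line of n cells, of which the i-th
-- contributes t i to its first vertex and b i to its second one, while a and ω
-- are external contributions to the two ends of the line.
junction : ∀ n → ℕ → ℕ → (Fin n → ℕ) → (Fin n → ℕ) → Fin (suc n) → ℕ
junction zero    a ω t b _       = a ℕ.+ ω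
junction (suc n) a ω t b zero    = a ℕ.+ t zero
junction (suc n) a ω t b (suc p) = junction n (b zero) ω (t ∘ suc) (b ∘ suc) p

junction-cong : ∀ n {a a′} ω {t t′ b b′ : Fin n → ℕ} p → a ≡ a′ →
  (∀ i → t i ≡ t′ i) → (∀ i → b i ≡ b′ i) → junction n a ω t b p ≡ junction n a′ ω t′ b′ p
junction-cong zero    ω p       a≡ t≡ b≡ = cong (ℕ._+ ω) a≡
junction-cong (suc n) ω zero    a≡ t≡ b≡ = cong₂ ℕ._+_ a≡ (t≡ zero)
junction-cong (suc n) ω (suc p) a≡ t≡ b≡ = junction-cong n ω p (b≡ zero) (t≡ ∘ suc) (b≡ ∘ suc)

-- The initial contribution reaches only the first vertex. In `junction-hit` this settles an edge at
-- the second vertex of the first cell, which is the first vertex of the remaining line.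
junction-suc : ∀ n a ω (t b : Fin n → ℕ) p →
  junction n (suc a) ω t b p ≡ mark (does (p Fin.≟ zero)) ℕ.+ junction n a ω t b p
junction-suc zero    a ω t b zero    = ≡.refl
junction-suc (suc n) a ω t b zero    = ≡.refl
junction-suc (suc n) a ω t b (suc p) = ≡.refl

hit : Fin 2 → Fin 2 → ℕ
hit 0F 0F = 1
hit 0F 1F = 0
hit 1F 0F = 0
hit 1F 1F = 1

-- An edge in the cell `i₀` touches the line only at `shift i₀ c`. The induction runs along the
-- line, each cell handing the contribution to its second vertex on as the initial contribution of
-- the rest.
junction-hit : ∀ n a ω (t b : Fin n → ℕ) i₀ c p →
  junction n a ω (λ i → mark (does (i Fin.≟ i₀)) ℕ.* hit 0F c ℕ.+ t i)
                 (λ i → mark (does (i Fin.≟ i₀)) ℕ.* hit 1F c ℕ.+ b i) p ≡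
  mark (does (p Fin.≟ shift i₀ c)) ℕ.+ junction n a ω t b p
junction-hit (suc n) a ω t b zero     0F zero    = ℕ.+-suc a (t zero)
junction-hit (suc n) a ω t b zero     1F zero    = ≡.refl
junction-hit (suc n) a ω t b zero     0F (suc p) = ≡.refl
junction-hit (suc n) a ω t b zero     1F (suc p) = junction-suc n _ ω _ _ p
junction-hit (suc n) a ω t b (suc i₀) 0F zero    = ≡.refl
junction-hit (suc n) a ω t b (suc i₀) 1F zero    = ≡.refl
junction-hit (suc n) a ω t b (suc i₀) 0F (suc p) = junction-hit n _ ω _ _ i₀ 0F p
junction-hit (suc n) a ω t b (suc i₀) 1F (suc p) = junction-hit n _ ω _ _ i₀ 1F p

-- The Boolean `hits` tells whether the new edge belongs to a cell of this line at all, so that one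
-- statement covers all lines of the grid.
junction-step : ∀ n a ω {t t′ b b′ : Fin n → ℕ} i₀ c hits p →
  (∀ i → t′ i ≡ mark (does (i Fin.≟ i₀) ∧ hits) ℕ.* hit 0F c ℕ.+ t i) →
  (∀ i → b′ i ≡ mark (does (i Fin.≟ i₀) ∧ hits) ℕ.* hit 1F c ℕ.+ b i) →
  junction n a ω t′ b′ p ≡ mark (does (p Fin.≟ shift i₀ c) ∧ hits) ℕ.+ junction n a ω t b p
junction-step n a ω {t} {_} {b} i₀ c true p t≡ b≡ = ≡.trans
  (junction-cong n ω p ≡.refl
    (λ i → ≡.trans (t≡ i) (cong (λ m → mark m ℕ.* hit 0F c ℕ.+ t i) (Bool.∧-identityʳ (does (i Fin.≟ i₀)))))
    (λ i → ≡.trans (b≡ i) (cong (λ m → mark m ℕ.* hit 1F c ℕ.+ b i) (Bool.∧-identityʳ (does (i Fin.≟ i₀))))))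
  (≡.trans (junction-hit n a ω t b i₀ c p)
    (cong (λ m → mark m ℕ.+ junction n a ω t b p) (≡.sym (Bool.∧-identityʳ (does (p Fin.≟ shift i₀ c))))))
junction-step n a ω {t} {_} {b} i₀ c false p t≡ b≡ = ≡.trans
  (junction-cong n ω p ≡.refl
    (λ i → ≡.trans (t≡ i) (cong (λ m → mark m ℕ.* hit 0F c ℕ.+ t i) (Bool.∧-zeroʳ (does (i Fin.≟ i₀)))))
    (λ i → ≡.trans (b≡ i) (cong (λ m → mark m ℕ.* hit 1F c ℕ.+ b i) (Bool.∧-zeroʳ (does (i Fin.≟ i₀))))))
  (cong (λ m → mark m ℕ.+ junction n a ω t b p) (≡.sym (Bool.∧-zeroʳ (does (p Fin.≟ shift i₀ c)))))

-- Degrees in terms of the edges chosen in each cell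

cell≟ : DecidableEquality (Cell n)
cell≟ = Productₚ.≡-dec Fin._≟_ Fin._≟_

infix 6 _at_

_at_ : List (Cell n × Corner) → Cell n → List Corner
[]            at c = []
((c₀ , k) ∷ es) at c = if does (cell≟ c c₀) then k ∷ es at c else es at c

at-++ : ∀ (es es′ : List (Cell n × Corner)) c → (es ++ es′) at c ≡ es at c ++ es′ at c
at-++ []              es′ c = ≡.refl
at-++ ((c₀ , k) ∷ es) es′ c with does (cell≟ c c₀)
... | true  = cong (k ∷_) (at-++ es es′ c)
... | false = at-++ es es′ c

at-self : ∀ (c : Cell n) ks → map (c ,_) ks at c ≡ ks
at-self c []       = ≡.refl
at-self c (k ∷ ks) with cell≟ c c
... | yes _ = cong (k ∷_) (at-self c ks)
... | no c≢c = contradiction ≡.refl c≢c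

at-other : ∀ {c : Cell n} {es : List (Cell n × Corner)} → All (λ e → c ≢ proj₁ e) es → es at c ≡ []
at-other []                                = ≡.refl
at-other {c = c} {es = (c₀ , _) ∷ _} (c≢ ∷ es) with cell≟ c c₀
... | yes eq = contradiction eq c≢
... | no _   = at-other es

-- Splits an incidence test in the grid into a test along a line and a test for the line itself, the
-- form that `junction-step` expects.
does-≡-dec : ∀ {I J : Set} (_≟₁_ : DecidableEquality I) (_≟₂_ : DecidableEquality J) i j i₀ j₀ →
  does (Productₚ.≡-dec _≟₁_ _≟₂_ (i , j) (i₀ , j₀)) ≡ does (i ≟₁ i₀) ∧ does (j ≟₂ j₀)
does-≡-dec _≟₁_ _≟₂_ i j i₀ j₀ with i ≟₁ i₀
... | no _       = ≡.refl
... | yes ≡.refl with j ≟₂ j₀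
...   | yes ≡.refl = ≡.refl
...   | no _       = ≡.refl

count : (Corner → Fin 2) → Fin 2 → List Corner → ℕ
count f c []       = 0
count f c (k ∷ ks) = hit c (f k) ℕ.+ count f c ks

count-at-∷ : ∀ f c (i j i₀ j₀ : Fin n) k es → let d = i , j; d₀ = i₀ , j₀ in
  count f c (((d₀ , k) ∷ es) at d) ≡
  mark (does (i Fin.≟ i₀) ∧ does (j Fin.≟ j₀)) ℕ.* hit c (f k) ℕ.+ count f c (es at d)
count-at-∷ f c i j i₀ j₀ k es
  rewrite ≡.sym (does-≡-dec Fin._≟_ Fin._≟_ i j i₀ j₀) with does (cell≟ (i , j) (i₀ , j₀))
... | true  = cong (ℕ._+ count f c (es at (i , j))) (≡.sym (ℕ.+-identityʳ (hit c (f k))))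
... | false = ≡.refl

-- The ends of the lines are the boundary vertices. With `x` = 0 the whole diamond is matched; with
-- `x` = 1 the boundary vertices count as already matched, which leaves the smaller diamond.
external : ℕ → AztecVertex n → ℕ
external x (u p j) = junction _ x x (const 0) (const 0) p
external x (v i q) = junction _ x x (const 0) (const 0) q

degree-cons : ∀ G p e es → degree G p (e ∷ es) ≡ mark (does (Graph.incident? G p e)) ℕ.+ degree G p es
degree-cons G p e es with does (Graph.incident? G p e)
... | true  = ≡.refl
... | false = ≡.refl

private
  +-cons : ∀ x {d m d′ j} → d ≡ m ℕ.+ d′ → x ℕ.+ d′ ≡ j → x ℕ.+ d ≡ m ℕ.+ j
  +-cons x {m = m} {d′} ≡.refl ≡.refl = ≡.trans (≡.sym (ℕ.+-assoc x m d′))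
    (≡.trans (cong (ℕ._+ d′) (ℕ.+-comm x m)) (ℕ.+-assoc m x d′))

-- The edges at `u p j` all lie in cells `(i , j)` with this `j`, so the cells of one column form a
-- line through these vertices. Thus the degree depends on `es` only through its parts in single
-- cells.
degree-u : ∀ x (p : Fin (suc n)) j es → external x (u p j) ℕ.+ degree (cellGraph n) (u p j) es ≡
  junction n x x (λ i → count proj₁ 0F (es at (i , j))) (λ i → count proj₁ 1F (es at (i , j))) p
degree-u x p j [] = ℕ.+-identityʳ _
degree-u {n} x p j (e@((i₀ , j₀) , k) ∷ es) = ≡.trans
  (+-cons (external x (u p j))
    (≡.trans (degree-cons (cellGraph n) (u p j) e es)
      (cong (λ m → mark m ℕ.+ degree (cellGraph n) (u p j) es)
        (≡.trans (Bool.∨-identityʳ _)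
          (does-≡-dec Fin._≟_ Fin._≟_ p j (shift i₀ (proj₁ k)) j₀))))
    (degree-u x p j es))
  (≡.sym (junction-step n x x i₀ (proj₁ k) (does (j Fin.≟ j₀)) p
    (λ i → count-at-∷ proj₁ 0F i j i₀ j₀ k es)
    (λ i → count-at-∷ proj₁ 1F i j i₀ j₀ k es)))

degree-v : ∀ x i (q : Fin (suc n)) es → external x (v i q) ℕ.+ degree (cellGraph n) (v i q) es ≡
  junction n x x (λ j → count proj₂ 0F (es at (i , j))) (λ j → count proj₂ 1F (es at (i , j))) q
degree-v x i q [] = ℕ.+-identityʳ _
degree-v {n} x i q (e@((i₀ , j₀) , k) ∷ es) = ≡.trans
  (+-cons (external x (v i q))
    (≡.trans (degree-cons (cellGraph n) (v i q) e es)
      (cong (λ m → mark m ℕ.+ degree (cellGraph n) (v i q) es)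
        (≡.trans (does-≡-dec Fin._≟_ Fin._≟_ i q i₀ (shift j₀ (proj₂ k)))
          (Bool.∧-comm (does (i Fin.≟ i₀)) _))))
    (degree-v x i q es))
  (≡.sym (junction-step n x x j₀ (proj₂ k) (does (i Fin.≟ i₀)) q
    (λ j → flip-∧ 0F j) (λ j → flip-∧ 1F j)))
  where
  flip-∧ : ∀ c j → _
  flip-∧ c j = ≡.trans (count-at-∷ proj₂ c i j i₀ j₀ k es)
    (cong (λ m → mark m ℕ.* hit c (proj₂ k) ℕ.+ count proj₂ c (es at (i , j)))
      (Bool.∧-comm (does (i Fin.≟ i₀)) (does (j Fin.≟ j₀))))

bits : List Bool
bits = true ∷ false ∷ []

opp : Fin 2 → Fin 2
opp 0F = 1F
opp 1F = 0F

opp-involutive : ∀ a → opp (opp a) ≡ a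
opp-involutive 0F = ≡.refl
opp-involutive 1F = ≡.refl

-- The two Aztec diamonds inside the cell graph

aztecEnds-remQuot : ∀ n r s {i a j b} → remQuot {n} 2 r ≡ (i , a) → remQuot {n} 2 s ≡ (j , b) →
  aztecEnds n (r , s) ≡ (u (shift i a) j , v i (shift j b))
aztecEnds-remQuot n r s p q with remQuot {n} 2 r | remQuot {n} 2 s
aztecEnds-remQuot n r s ≡.refl ≡.refl | i , 0F | j , 0F = ≡.refl
aztecEnds-remQuot n r s ≡.refl ≡.refl | i , 0F | j , 1F = ≡.refl
aztecEnds-remQuot n r s ≡.refl ≡.refl | i , 1F | j , 0F = ≡.refl
aztecEnds-remQuot n r s ≡.refl ≡.refl | i , 1F | j , 1F = ≡.refl

remQuot-injective : ∀ {n} {r s : Fin (n ℕ.* 2)} → remQuot {n} 2 r ≡ remQuot {n} 2 s → r ≡ s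
remQuot-injective {n} {r} {s} eq = ≡.trans (≡.sym (Fin.combine-remQuot {n} 2 r))
  (≡.trans (cong (λ (i , a) → combine i a) eq) (Fin.combine-remQuot {n} 2 s))

cellEdge : Fin n × Fin 2 → Fin n × Fin 2 → Cell n × Corner
cellEdge (i , a) (j , b) = (i , j) , (a , b)

cellEdge-injective : ∀ {p q p′ q′ : Fin n × Fin 2} → cellEdge p q ≡ cellEdge p′ q′ → p ≡ p′ × q ≡ q′
cellEdge-injective ≡.refl = ≡.refl , ≡.refl

external-0 : ∀ (p : AztecVertex n) → external 0 p ≡ 0
external-0 = λ where
    (u p j) → zeros _ p
    (v i q) → zeros _ q
  where
  zeros : ∀ n (p : Fin (suc n)) → junction n 0 0 (const 0) (const 0) p ≡ 0
  zeros zero    p       = ≡.refl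
  zeros (suc n) zero    = ≡.refl
  zeros (suc n) (suc p) = zeros n p

whole : ∀ n → Embedding (AD n) (cellGraph n) (external 0)
whole n = record
  { onVertex         = id
  ; onEdge           = λ (r , s) → cellEdge (remQuot {n} 2 r) (remQuot {n} 2 s)
  ; vertex-injective = id
  ; edge-injective   = λ eq → let (p , q) = cellEdge-injective eq in
      cong₂ _,_ (remQuot-injective {n} p) (remQuot-injective {n} q)
  ; incident⁺        = λ {p} {(r , s)} →
      subst (λ ends → p ≡ proj₁ ends ⊎ p ≡ proj₂ ends) (aztecEnds-remQuot n r s ≡.refl ≡.refl)
  ; incident⁻        = λ {p} {(r , s)} inc → p , ≡.refl ,
      subst (λ ends → p ≡ proj₁ ends ⊎ p ≡ proj₂ ends) (≡.sym (aztecEnds-remQuot n r s ≡.refl ≡.refl)) inc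
  ; ext-inner        = external-0
  ; ext-outer        = λ p → inj₁ (p , ≡.refl)
  ; edge-outer       = λ ((i , j) , (a , b)) → inj₁ ((combine i a , combine j b) , ≡.sym
      (cong₂ cellEdge (Fin.remQuot-combine i a) (Fin.remQuot-combine j b)))
  }

-- AD m sits in the middle of AD (m+1) with its edges moved by one row and one
-- column: row 2k+a becomes row 2k+a+1 = 2(k+a) + (1-a), counting from 0.
halfStep : Fin m × Fin 2 → Fin (suc m) × Fin 2
halfStep (k , a) = shift k a , opp a

halfStep-injective : ∀ {p q : Fin m × Fin 2} → halfStep p ≡ halfStep q → p ≡ q
halfStep-injective {p = k , 0F} {q = l , 0F} eq = cong (_, 0F) (Fin.inject₁-injective (cong proj₁ eq))
halfStep-injective {p = k , 1F} {q = l , 1F} eq = cong (_, 1F) (Fin.suc-injective (cong proj₁ eq))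
halfStep-injective {p = k , 0F} {q = l , 1F} eq = contradiction (cong proj₂ eq) λ ()
halfStep-injective {p = k , 1F} {q = l , 0F} eq = contradiction (cong proj₂ eq) λ ()

shift-halfStep : ∀ (k : Fin m) a → shift (shift k a) (opp a) ≡ suc (inject₁ k)
shift-halfStep k 0F = ≡.refl
shift-halfStep k 1F = ≡.refl

-- Contributions 0 at the start and 1 at the end mark only the last vertex. This is what remains of
-- a line marked at both ends once its first vertex is dropped.
inject₁? : ∀ m (p : Fin (suc m)) →
  (∃ λ k → p ≡ inject₁ k) ⊎ junction m 0 1 (const 0) (const 0) p ≡ 1
inject₁? zero    zero    = inj₂ ≡.refl
inject₁? (suc m) zero    = inj₁ (zero , ≡.refl)
inject₁? (suc m) (suc p) with inject₁? m p
... | inj₁ (k , eq) = inj₁ (suc k , cong suc eq)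
... | inj₂ ext≡1    = inj₂ ext≡1

interior-0 : ∀ m (k : Fin m) → junction m 0 1 (const 0) (const 0) (inject₁ k) ≡ 0
interior-0 (suc m) zero    = ≡.refl
interior-0 (suc m) (suc k) = interior-0 m k

interior? : ∀ (p : Fin (suc (suc m))) →
  (∃ λ k → p ≡ suc (inject₁ k)) ⊎ junction (suc m) 1 1 (const 0) (const 0) p ≡ 1
interior? zero        = inj₂ ≡.refl
interior? {m} (suc p) with inject₁? m p
... | inj₁ (k , eq) = inj₁ (k , cong suc eq)
... | inj₂ ext≡1    = inj₂ ext≡1

-- The rows of edges missing from the smaller diamond are the first half of the first cell and the
-- second half of the last one; exactly these reach an end of the line.
halfStep? : ∀ (i : Fin (suc m)) a →
  (∃ λ p → (i , a) ≡ halfStep p) ⊎ junction (suc m) 1 1 (const 0) (const 0) (shift i a) ≡ 1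
halfStep? zero        0F = inj₂ ≡.refl
halfStep? (suc k)     0F = inj₁ ((k , 1F) , ≡.refl)
halfStep? {m} i       1F with inject₁? m i
... | inj₁ (k , ≡.refl) = inj₁ ((k , 0F) , ≡.refl)
... | inj₂ ext≡1        = inj₂ ext≡1

-- A move by half a cell in both directions exchanges the two colour classes. The coordinates
-- `suc (inject₁ _)` avoid both ends of a line.
swapVertex : AztecVertex m → AztecVertex (suc m)
swapVertex (u p l) = v p (suc (inject₁ l))
swapVertex (v k q) = u (suc (inject₁ k)) q

swapVertex-injective : ∀ {p q : AztecVertex m} → swapVertex p ≡ swapVertex q → p ≡ q
swapVertex-injective {p = u p l} {q = u p′ l′} eq =
  cong₂ u (cong proj₁ (Sumₚ.inj₂-injective eq))
          (Fin.inject₁-injective (Fin.suc-injective (cong proj₂ (Sumₚ.inj₂-injective eq))))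
swapVertex-injective {p = v k q} {q = v k′ q′} eq =
  cong₂ v (Fin.inject₁-injective (Fin.suc-injective (cong proj₁ (Sumₚ.inj₁-injective eq))))
          (cong proj₂ (Sumₚ.inj₁-injective eq))

inner : ∀ m → Embedding (AD m) (cellGraph (suc m)) (external 1)
inner m = record
  { onVertex         = swapVertex
  ; onEdge           = onEdge
  ; vertex-injective = swapVertex-injective
  ; edge-injective   = λ eq → let (p , q) = cellEdge-injective eq in
      cong₂ _,_ (remQuot-injective {m} (halfStep-injective p)) (remQuot-injective {m} (halfStep-injective q))
  ; incident⁺        = λ {p} {e} → incident⁺ {p} {e}
  ; incident⁻        = λ {q} {e} → incident⁻ {q} {e}
  ; ext-inner        = λ where
      (u p l) → interior-0 m l
      (v k q) → interior-0 m k
  ; ext-outer        = ext-outer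
  ; edge-outer       = edge-outer
  }
  where
  H = cellGraph (suc m)

  onEdge : AztecEdge m → Cell (suc m) × Corner
  onEdge (r , s) = cellEdge (halfStep (remQuot {m} 2 r)) (halfStep (remQuot {m} 2 s))

  ends-onEdge : ∀ e → Graph.ends H (onEdge e) ≡
    (swapVertex (proj₂ (aztecEnds m e)) , swapVertex (proj₁ (aztecEnds m e)))
  ends-onEdge (r , s) = ≡.trans
    (let (k , a) = remQuot {m} 2 r; (l , b) = remQuot {m} 2 s in
      cong₂ (λ p q → u p (shift l b) , v (shift k a) q) (shift-halfStep k a) (shift-halfStep l b))
    (cong (λ (p , q) → swapVertex q , swapVertex p) (≡.sym (aztecEnds-remQuot m r s ≡.refl ≡.refl)))

  incident⁺ : ∀ {p e} → Graph.Incident (AD m) p e → Graph.Incident H (swapVertex p) (onEdge e)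
  incident⁺ {e = e} (inj₁ ≡.refl) = inj₂ (≡.sym (cong proj₂ (ends-onEdge e)))
  incident⁺ {e = e} (inj₂ ≡.refl) = inj₁ (≡.sym (cong proj₁ (ends-onEdge e)))

  incident⁻ : ∀ {q e} → Graph.Incident H q (onEdge e) →
    ∃ λ p → q ≡ swapVertex p × Graph.Incident (AD m) p e
  incident⁻ {e = e} (inj₁ eq) = _ , ≡.trans eq (cong proj₁ (ends-onEdge e)) , inj₂ ≡.refl
  incident⁻ {e = e} (inj₂ eq) = _ , ≡.trans eq (cong proj₂ (ends-onEdge e)) , inj₁ ≡.refl

  ext-outer : ∀ q → (∃ λ p → q ≡ swapVertex p) ⊎ external 1 q ≡ 1
  ext-outer (u p j) with interior? p
  ... | inj₁ (k , ≡.refl) = inj₁ (v k j , ≡.refl)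
  ... | inj₂ ext≡1        = inj₂ ext≡1
  ext-outer (v i q) with interior? q
  ... | inj₁ (l , ≡.refl) = inj₁ (u i l , ≡.refl)
  ... | inj₂ ext≡1        = inj₂ ext≡1

  edge-outer : ∀ x → (∃ λ e → x ≡ onEdge e) ⊎ (∃ λ q → Graph.Incident H q x × external 1 q ≡ 1)
  edge-outer ((i , j) , (a , b)) with halfStep? i a | halfStep? j b
  ... | inj₂ ext≡1         | _            = inj₂ (_ , inj₁ ≡.refl , ext≡1)
  ... | inj₁ _             | inj₂ ext≡1   = inj₂ (_ , inj₂ ≡.refl , ext≡1)
  ... | inj₁ ((k , a) , p) | inj₁ ((l , b) , q) = inj₁ ((combine k a , combine l b) ,
    cong₂ cellEdge (≡.trans p (cong halfStep (≡.sym (Fin.remQuot-combine k a))))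
                   (≡.trans q (cong halfStep (≡.sym (Fin.remQuot-combine l b)))))

-- Parities of the columns

parity-suc : ∀ k → parity (suc k) ≡ flip (parity k)
parity-suc zero          = ≡.refl
parity-suc (suc zero)    = ≡.refl
parity-suc (suc (suc k)) = parity-suc k

parity≡0⇒2∣ : ∀ k → parity k ≡ 0ℙ → 2 ∣ k
parity≡0⇒2∣ zero          _  = divides 0 ≡.refl
parity≡0⇒2∣ (suc (suc k)) eq = ∣m∣n⇒∣m+n ∣-refl (parity≡0⇒2∣ k eq)

2∣⇒parity≡0 : ∀ {k} → 2 ∣ k → parity k ≡ 0ℙ
2∣⇒parity≡0 (divides q ≡.refl) = even-double q
  where
  even-double : ∀ q → parity (q ℕ.* 2) ≡ 0ℙ
  even-double zero    = ≡.refl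
  even-double (suc q) = even-double q

2∤⇒parity≡1 : ∀ {k} → 2 ∤ k → parity k ≡ 1ℙ
2∤⇒parity≡1 {k} 2∤k with parity k in eq
... | 0ℙ = contradiction (parity≡0⇒2∣ k eq) 2∤k
... | 1ℙ = ≡.refl

columnType : Parity → Fin 2 → Fin 4
columnType 0ℙ 0F = 1F
columnType 0ℙ 1F = 2F
columnType 1ℙ 0F = 3F
columnType 1ℙ 1F = 0F

column-mod4 : ∀ k (b : Fin 2) → suc (k ℕ.* 2 ℕ.+ toℕ b) mod 4 ≡ columnType (parity k) b
column-mod4 0             0F = ≡.refl
column-mod4 0             1F = ≡.refl
column-mod4 1             0F = ≡.refl
column-mod4 1             1F = ≡.refl
-- Two more cells raise the column number by 4. The remainders then agree by computation, and going
-- through `toℕ` discards the bound proofs stored by `mod`.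
column-mod4 (suc (suc k)) b  = ≡.trans
  (Fin.toℕ-injective (≡.trans (Fin.toℕ-fromℕ< _) (≡.sym (Fin.toℕ-fromℕ< _))))
  (column-mod4 k b)

columnType-remQuot : ∀ n (s : Fin (n ℕ.* 2)) {j b} → remQuot {n} 2 s ≡ (j , b) →
  suc (toℕ s) mod 4 ≡ columnType (parity (toℕ j)) b
columnType-remQuot n s {j} {b} eq = ≡.trans (cong (λ k → suc k mod 4) (begin
  toℕ s                     ≡⟨ cong toℕ (Fin.combine-remQuot {n} 2 s) ⟨
  _                         ≡⟨ cong (λ (j , b) → toℕ (combine j b)) eq ⟩
  toℕ (combine j b)         ≡⟨ Fin.toℕ-combine j b ⟩
  2 ℕ.* toℕ j ℕ.+ toℕ b     ≡⟨ cong (ℕ._+ toℕ b) (ℕ.*-comm 2 (toℕ j)) ⟩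
  toℕ j ℕ.* 2 ℕ.+ toℕ b     ∎)) (column-mod4 (toℕ j) b)
  where open ≡.≡-Reasoning

-- Partition functions with values in the ring

module Reduction {c ℓ} (R : CommutativeRing c ℓ) where

  open CommutativeRing R hiding (zero)
  open Weights R
  open SetoidReasoning setoid
  open CommutativeSemigroupProperties *-commutativeSemigroup using (interchange; x∙yz≈y∙xz)

  module ∏ = FiniteSum *-commutativeMonoid
  module Sum = BigOperator +-commutativeMonoid
  module Product = BigOperator *-commutativeMonoid

  ∑ : List A → (A → Carrier) → Carrier
  ∑ = Sum.fold

  ∏ᴸ : List A → (A → Carrier) → Carrier
  ∏ᴸ = Product.fold

  ⟨_⟩ : Bool → Carrier
  ⟨ b ⟩ = if b then 1# else 0#

  ⟨⟩-∧ : ∀ b b′ → ⟨ b ∧ b′ ⟩ ≈ ⟨ b ⟩ * ⟨ b′ ⟩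
  ⟨⟩-∧ true  b′ = sym (*-identityˡ _)
  ⟨⟩-∧ false b′ = sym (zeroˡ _)

  ∑-filter : ∀ {P : Pred A b} (P? : Decidable P) xs f →
    ∑ (filter P? xs) f ≈ ∑ xs (λ x → f x * ⟨ does (P? x) ⟩)
  ∑-filter P? []       f = refl
  ∑-filter P? (x ∷ xs) f with does (P? x)
  ... | true  = +-cong (sym (*-identityʳ _)) (∑-filter P? xs f)
  ... | false = trans (sym (+-identityˡ _)) (+-cong (sym (zeroʳ _)) (∑-filter P? xs f))

  ⟨all?⟩ : ∀ {P : Pred A b} (P? : Decidable P) xs →
    ⟨ does (All.all? P? xs) ⟩ ≈ ∏ᴸ xs (λ x → ⟨ does (P? x) ⟩)
  ⟨all?⟩ P? []       = refl
  ⟨all?⟩ P? (x ∷ xs) = trans (⟨⟩-∧ (does (P? x)) _) (*-congˡ (⟨all?⟩ P? xs))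

  ∏ᴸ-zero : ∀ {x} {xs : List A} f → x ∈ xs → f x ≈ 0# → ∏ᴸ xs f ≈ 0#
  ∏ᴸ-zero f x∈xs fx≈0 with ∈-∃++ x∈xs
  ... | ys , zs , ≡.refl = begin
    ∏ᴸ (ys ++ _ ∷ zs) f        ≈⟨ Product.fold-++ ys _ f ⟩
    ∏ᴸ ys f * (f _ * ∏ᴸ zs f)  ≈⟨ *-congˡ (trans (*-congʳ fx≈0) (zeroˡ _)) ⟩
    ∏ᴸ ys f * 0#               ≈⟨ zeroʳ _ ⟩
    0#                         ∎

  -- The sum over the sets of edges which give each vertex p, together with
  -- ext p further edge ends, the degree 1.
  Z : (G : Graph) → (Graph.Vertex G → ℕ) → (Graph.Edge G → Carrier) → Carrier
  Z G ext w = ∑ (subsets edges) λ es →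
    ∏ᴸ es w * ∏ᴸ vertices (λ p → ⟨ ext p ℕ.+ degree G p es ≡ᵇ 1 ⟩)
    where open Graph G

  M≈Z : ∀ G wt → M G wt ≈ Z G (const 0) (⟦_⟧ ∘ wt)
  M≈Z G wt = trans (∑-filter isPerfectMatching? (subsets edges) _)
    (Sum.fold-cong (subsets edges) λ es →
      *-congˡ (⟨all?⟩ (λ p → degree G p es ℕ.≟ 1) vertices))
    where open Graph G

  -- An edge of H outside the image meets a vertex of external degree 1, whose total degree would
  -- exceed 1, so only sets of image edges contribute. For these the outer vertices have degree
  -- exactly 1 and give the factor 1.
  Z-embedding : ∀ {G H ext} (f : Embedding G H ext) {w wᴴ} →
    (∀ e → wᴴ (Embedding.onEdge f e) ≈ w e) → Z G (const 0) w ≈ Z H ext wᴴ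
  Z-embedding {G} {H} {ext} f {w} {wᴴ} wᴴ≈w
    with ↭-image (Embedding.edge-injective f) (Embedding.edge-outer f)
           (λ e (q , inc , ext≡1) → 1≢0 ext≡1 (Embedding.ext-ends f inc))
           (Graph.edges-all G) (Graph.edges-unique G) (Graph.edges-all H) (Graph.edges-unique H)
       | ↭-image {N = λ q → ext q ≡ 1} (Embedding.vertex-injective f) (Embedding.ext-outer f)
           (λ p ext≡1 → 1≢0 ext≡1 (Embedding.ext-inner f p))
           (Graph.vertices-all G) (Graph.vertices-unique G)
           (Graph.vertices-all H) (Graph.vertices-unique H)
  ... | es₀ , edges↭ , outer-edges | vs₀ , vertices↭ , outer-vertices = begin
    ∑ (subsets G.edges) (λ es → ∏ᴸ es w * ∏ᴸ G.vertices (λ p → ⟨ degree G p es ≡ᵇ 1 ⟩))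
      ≈⟨ Sum.fold-cong (subsets G.edges) term ⟩
    ∑ (subsets G.edges) (Φ ∘ map onEdge)
      ≈⟨ Sum.fold-subsets-map onEdge G.edges Φ ⟨
    ∑ (subsets (map onEdge G.edges)) Φ
      ≈⟨ Sum.fold-subsets-discard Φ (All.map vanish outer-edges) ⟨
    ∑ (subsets (es₀ ++ map onEdge G.edges)) Φ
      ≈⟨ Sum.fold-subsets-↭ Φ Φ-↭ edges↭ ⟨
    ∑ (subsets H.edges) Φ ∎
    where
    open Embedding f
    module G = Graph G
    module H = Graph H

    Φ : List H.Edge → Carrier
    Φ xs = ∏ᴸ xs wᴴ * ∏ᴸ H.vertices (λ q → ⟨ ext q ℕ.+ degree H q xs ≡ᵇ 1 ⟩)

    Φ-↭ : ∀ {xs ys} → xs ↭ ys → Φ xs ≈ Φ ys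
    Φ-↭ xs↭ys = *-cong (Product.fold-↭ wᴴ xs↭ys) (Product.fold-cong H.vertices λ q →
      reflexive (cong (λ d → ⟨ ext q ℕ.+ d ≡ᵇ 1 ⟩)
        (↭.↭-length (↭.filter-↭ (H.incident? q) xs↭ys))))

    vanish : ∀ {x} → (∃ λ q → H.Incident q x × ext q ≡ 1) → ∀ xs → Φ (x ∷ xs) ≈ 0#
    vanish {x} (q , inc , ext≡1) xs = trans (*-congˡ
      (∏ᴸ-zero _ (H.vertices-all q) (reflexive (cong (λ d → ⟨ d ≡ᵇ 1 ⟩)
        (≡.cong₂ ℕ._+_ ext≡1 (degree-∷ H q x xs inc)))))) (zeroʳ _)

    term : ∀ es → ∏ᴸ es w * ∏ᴸ G.vertices (λ p → ⟨ degree G p es ≡ᵇ 1 ⟩) ≈ Φ (map onEdge es)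
    term es = *-cong
      (trans (Product.fold-cong es (sym ∘ wᴴ≈w))
             (reflexive (≡.sym (Product.fold-map onEdge es wᴴ))))
      (begin
        ∏ᴸ G.vertices (λ p → ⟨ degree G p es ≡ᵇ 1 ⟩)
          ≈⟨ Product.fold-cong G.vertices (λ p → reflexive (cong (λ d → ⟨ d ≡ᵇ 1 ⟩)
               (≡.cong₂ ℕ._+_ (ext-inner p) (degree-inner p es)))) ⟨
        ∏ᴸ G.vertices (δ ∘ onVertex)
          ≡⟨ Product.fold-map onVertex G.vertices δ ⟨
        ∏ᴸ (map onVertex G.vertices) δ
          ≈⟨ *-identityˡ _ ⟨
        1# * ∏ᴸ (map onVertex G.vertices) δ
          ≈⟨ *-congʳ (Product.fold-ε (All.map (λ {q} ext≡1 → reflexive (cong (λ d → ⟨ d ≡ᵇ 1 ⟩)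
               (≡.cong₂ ℕ._+_ ext≡1 (degree-outer q ext≡1 es)))) outer-vertices)) ⟨
        ∏ᴸ vs₀ δ * ∏ᴸ (map onVertex G.vertices) δ
          ≈⟨ Product.fold-++ vs₀ _ δ ⟨
        ∏ᴸ (vs₀ ++ map onVertex G.vertices) δ
          ≈⟨ Product.fold-↭ δ vertices↭ ⟨
        ∏ᴸ H.vertices δ ∎)
      where
      δ : H.Vertex → Carrier
      δ q = ⟨ ext q ℕ.+ degree H q (map onEdge es) ≡ᵇ 1 ⟩

  -- Distributivity and factorisation over the cells

  ∑-distribˡ : ∀ x (xs : List A) f → x * ∑ xs f ≈ ∑ xs (λ y → x * f y)
  ∑-distribˡ x []       f = zeroʳ x
  ∑-distribˡ x (y ∷ ys) f = trans (distribˡ x _ _) (+-congˡ (∑-distribˡ x ys f))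

  ∑-distribʳ : ∀ x (xs : List A) f → ∑ xs f * x ≈ ∑ xs (λ y → f y * x)
  ∑-distribʳ x []       f = zeroˡ x
  ∑-distribʳ x (y ∷ ys) f = trans (distribʳ x _ _) (+-congˡ (∑-distribʳ x ys f))

  ∑-* : ∀ (xs : List A) (ys : List B) f g → ∑ xs f * ∑ ys g ≈ ∑ xs (λ x → ∑ ys (λ y → f x * g y))
  ∑-* xs ys f g = trans (∑-distribʳ _ xs f) (Sum.fold-cong xs λ x → ∑-distribˡ (f x) ys g)

  ∏-∑ : ∀ n (xs : List A) (f : Fin n → A → Carrier) →
    ∏ (λ i → ∑ xs (f i)) ≈ ∑ (vectors xs n) (λ s → ∏ (λ i → f i (lookup s i)))
  ∏-∑ zero    xs f = sym (+-identityʳ 1#)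
  ∏-∑ (suc n) xs f = begin
    ∑ xs (f zero) * ∏ (λ i → ∑ xs (f (suc i)))
      ≈⟨ *-congˡ (∏-∑ n xs (f ∘ suc)) ⟩
    ∑ xs (f zero) * ∑ (vectors xs n) (λ s → ∏ (λ i → f (suc i) (lookup s i)))
      ≈⟨ ∑-* xs (vectors xs n) _ _ ⟩
    ∑ xs (λ x → ∑ (vectors xs n) (λ s → f zero x * ∏ (λ i → f (suc i) (lookup s i))))
      ≈⟨ Sum.fold-cartesianProductWith _∷_ xs (vectors xs n) _ ⟨
    ∑ (vectors xs (suc n)) (λ s → ∏ (λ i → f i (lookup s i))) ∎

  ∏ᴸ-cells : ∀ m n (f : Fin m × Fin n → Carrier) →
    ∏ᴸ (cartesianProduct (allFin m) (allFin n)) f ≈ ∏ (λ i → ∏ (λ j → f (i , j)))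
  ∏ᴸ-cells m n f = trans (Product.fold-cartesianProductWith _,_ (allFin m) (allFin n) f)
    (trans (reflexive (Product.fold-tabulate {n = m} id (λ i → ∏ᴸ (allFin n) (λ j → f (i , j)))))
      (∏.sum-cong-≋ λ i → reflexive (Product.fold-tabulate {n = n} id (λ j → f (i , j)))))

  -- A set of edges is an independent choice of corners in each cell, so this is distributivity. An
  -- arbitrary list `cs` without repetitions makes the induction possible: the later edges do not
  -- affect the part in the first cell, nor conversely.
  factorise : ∀ (ks : List Corner) w (f : Cell n → List Corner → Carrier) {cs} → Unique cs →
    ∑ (subsets (cartesianProduct cs ks)) (λ es → ∏ᴸ es w * ∏ᴸ cs (λ c → f c (es at c))) ≈
    ∏ᴸ cs (λ c → ∑ (subsets ks) (λ k → ∏ᴸ k (λ x → w (c , x)) * f c k))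
  factorise ks w f {[]} [] = trans (+-identityʳ _) (*-identityˡ 1#)
  factorise ks w f {c ∷ cs} (c≢cs ∷ uniq) = begin
    ∑ (subsets (map (c ,_) ks ++ es₀)) Φ
      ≈⟨ Sum.fold-subsets-++ (map (c ,_) ks) es₀ Φ ⟩
    ∑ (subsets (map (c ,_) ks)) (λ as → ∑ (subsets es₀) (λ es → Φ (as ++ es)))
      ≈⟨ Sum.fold-subsets-map (c ,_) ks _ ⟩
    ∑ (subsets ks) (λ k → ∑ (subsets es₀) (λ es → Φ (map (c ,_) k ++ es)))
      ≈⟨ Sum.fold-cong (subsets ks) (λ k → Sum.fold-cong-All (All.map (split k) (subsets-All away))) ⟩
    ∑ (subsets ks) (λ k → ∑ (subsets es₀) (λ es →
      (∏ᴸ k (λ x → w (c , x)) * f c k) * (∏ᴸ es w * ∏ᴸ cs (λ c′ → f c′ (es at c′)))))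
      ≈⟨ ∑-* (subsets ks) (subsets es₀) _ _ ⟨
    ∑ (subsets ks) (λ k → ∏ᴸ k (λ x → w (c , x)) * f c k) *
    ∑ (subsets es₀) (λ es → ∏ᴸ es w * ∏ᴸ cs (λ c′ → f c′ (es at c′)))
      ≈⟨ *-congˡ (factorise ks w f uniq) ⟩
    ∏ᴸ (c ∷ cs) (λ c → ∑ (subsets ks) (λ k → ∏ᴸ k (λ x → w (c , x)) * f c k)) ∎
    where
    es₀ = cartesianProduct cs ks

    Φ : List (Cell _ × Corner) → Carrier
    Φ es = ∏ᴸ es w * (f c (es at c) * ∏ᴸ cs (λ c′ → f c′ (es at c′)))

    away : All (λ e → c ≢ proj₁ e) es₀
    away = All.cartesianProduct⁺ (≡.setoid _) (≡.setoid _) cs ks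
      (λ c′∈cs _ → All.lookup c≢cs c′∈cs)

    at-first : ∀ k es → All (λ e → c ≢ proj₁ e) es → (map (c ,_) k ++ es) at c ≡ k
    at-first k es c≢es = ≡.trans (at-++ (map (c ,_) k) es c)
      (≡.trans (cong₂ _++_ (at-self c k) (at-other c≢es)) (++-identityʳ k))

    at-rest : ∀ k es {c′} → c ≢ c′ → (map (c ,_) k ++ es) at c′ ≡ es at c′
    at-rest k es {c′} c≢c′ = ≡.trans (at-++ (map (c ,_) k) es c′)
      (cong (_++ es at c′) (at-other (All.map⁺ (All.universal (λ _ → c≢c′ ∘ ≡.sym) k))))

    split : ∀ k {es} → All (λ e → c ≢ proj₁ e) es → Φ (map (c ,_) k ++ es) ≈
      (∏ᴸ k (λ x → w (c , x)) * f c k) * (∏ᴸ es w * ∏ᴸ cs (λ c′ → f c′ (es at c′)))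
    split k {es} c≢es = trans
      (*-cong
        (trans (Product.fold-++ (map (c ,_) k) es w)
               (*-congʳ (reflexive (Product.fold-map (c ,_) k w))))
        (*-cong (reflexive (cong (f c) (at-first k es c≢es)))
          (Product.fold-cong-All (All.map (λ {c′} c≢c′ → reflexive (cong (f c′) (at-rest k es c≢c′))) c≢cs))))
      (interchange _ _ _ _)

  -- Bit s at a vertex between two cells says which of them its edge lies in:
  -- the next one for s = true.  Where o holds, all bits are complemented.
  inCell : Bool → Bool → ℕ
  inCell o s = mark (o xor s)

  -- From degree conditions to sums over bits

  ⟨+≡1⟩ : ∀ m n → ⟨ m ℕ.+ n ≡ᵇ 1 ⟩ ≈ ⟨ m ≡ᵇ 0 ⟩ * ⟨ n ≡ᵇ 1 ⟩ + ⟨ m ≡ᵇ 1 ⟩ * ⟨ n ≡ᵇ 0 ⟩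
  ⟨+≡1⟩ 0             n = sym (trans (+-cong (*-identityˡ _) (zeroˡ _)) (+-identityʳ _))
  ⟨+≡1⟩ 1             n = sym (trans (+-cong (zeroˡ _) (*-identityˡ _)) (+-identityˡ _))
  ⟨+≡1⟩ (suc (suc m)) n = sym (trans (+-cong (zeroˡ _) (zeroˡ _)) (+-identityˡ _))

  ⟨+≡1⟩-bits : ∀ o m n → ⟨ m ℕ.+ n ≡ᵇ 1 ⟩ ≈
    ∑ bits (λ s → ⟨ m ≡ᵇ inCell o (not s) ⟩ * ⟨ n ≡ᵇ inCell o s ⟩)
  ⟨+≡1⟩-bits false m n = trans (⟨+≡1⟩ m n) (+-congˡ (sym (+-identityʳ _)))
  ⟨+≡1⟩-bits true  m n = trans (⟨+≡1⟩ m n) (trans (+-comm _ _) (+-congˡ (sym (+-identityʳ _))))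

  -- One cell between two vertices with bits `s` and `s′`: it comes after the first vertex and
  -- before the second, hence the `not` at `s′` only.
  arrows : Bool → Bool → Bool → ℕ → ℕ → Carrier
  arrows o s s′ t b = ⟨ t ≡ᵇ inCell o s ⟩ * ⟨ b ≡ᵇ inCell o (not s′) ⟩

  first last : Vec Bool (suc n) → Bool
  first s = lookup s zero
  last {n} s = lookup s (fromℕ n)

  -- A transfer matrix argument: of the two contributions to a vertex one is 1 and the other 0, and
  -- summing over the choice decouples the neighbouring cells. The external `a` and `ω` act as cells
  -- beyond the two ends.
  junction-states : ∀ o n a ω (t b : Fin n → ℕ) →
    ∏ (λ p → ⟨ junction n a ω t b p ≡ᵇ 1 ⟩) ≈
    ∑ (vectors bits (suc n)) (λ s → ⟨ a ≡ᵇ inCell o (not (first s)) ⟩ *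
      (∏ (λ i → arrows o (lookup s (inject₁ i)) (lookup s (suc i)) (t i) (b i)) *
       ⟨ ω ≡ᵇ inCell o (last s) ⟩))
  junction-states o zero a ω t b = begin
    ⟨ a ℕ.+ ω ≡ᵇ 1 ⟩ * 1#
      ≈⟨ *-identityʳ _ ⟩
    ⟨ a ℕ.+ ω ≡ᵇ 1 ⟩
      ≈⟨ ⟨+≡1⟩-bits o a ω ⟩
    ∑ bits (λ s → ⟨ a ≡ᵇ inCell o (not s) ⟩ * ⟨ ω ≡ᵇ inCell o s ⟩)
      ≈⟨ Sum.fold-cong bits (λ s → *-congˡ {⟨ a ≡ᵇ inCell o (not s) ⟩} (sym (*-identityˡ ⟨ ω ≡ᵇ inCell o s ⟩))) ⟩
    ∑ bits (λ s → ⟨ a ≡ᵇ inCell o (not s) ⟩ * (1# * ⟨ ω ≡ᵇ inCell o s ⟩)) ∎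
  junction-states o (suc n) a ω t b = begin
    ⟨ a ℕ.+ t zero ≡ᵇ 1 ⟩ * ∏ (λ p → ⟨ junction n (b zero) ω (t ∘ suc) (b ∘ suc) p ≡ᵇ 1 ⟩)
      ≈⟨ *-cong (⟨+≡1⟩-bits o a (t zero)) (junction-states o n (b zero) ω (t ∘ suc) (b ∘ suc)) ⟩
    _ ≈⟨ ∑-* bits (vectors bits (suc n)) head rest ⟩
    ∑ bits (λ s → ∑ (vectors bits (suc n)) (λ s′ → head s * rest s′))
      ≈⟨ Sum.fold-cong bits (λ s → Sum.fold-cong (vectors bits (suc n)) (λ s′ →
           rearrange ⟨ a ≡ᵇ inCell o (not s) ⟩ ⟨ t zero ≡ᵇ inCell o s ⟩
             ⟨ b zero ≡ᵇ inCell o (not (first s′)) ⟩ (line s′) ⟨ ω ≡ᵇ inCell o (last s′) ⟩)) ⟩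
    _ ≈⟨ Sum.fold-cartesianProductWith _∷_ bits (vectors bits (suc n)) _ ⟨
    _ ∎
    where
    head : Bool → Carrier
    head s = ⟨ a ≡ᵇ inCell o (not s) ⟩ * ⟨ t zero ≡ᵇ inCell o s ⟩

    line rest : Vec Bool (suc n) → Carrier
    line s = ∏ (λ i → arrows o (lookup s (inject₁ i)) (lookup s (suc i)) (t (suc i)) (b (suc i)))
    rest s = ⟨ b zero ≡ᵇ inCell o (not (first s)) ⟩ * (line s * ⟨ ω ≡ᵇ inCell o (last s) ⟩)

    rearrange : ∀ p q r s t → (p * q) * (r * (s * t)) ≈ p * (((q * r) * s) * t)
    rearrange p q r s t = trans (*-assoc p q _)
      (*-congˡ (trans (sym (*-assoc q r _)) (sym (*-assoc _ s t))))

  -- For both values of `o` this is the indicator of first bit `true` and last bit `false`, the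
  -- domain wall condition of the six-vertex model. Complementing the bits for `o` = `true` is what
  -- makes the two conditions coincide.
  boundary : Bool → Vec Bool (suc n) → Carrier
  boundary o s = ⟨ mark o ≡ᵇ inCell o (not (first s)) ⟩ * ⟨ mark o ≡ᵇ inCell o (last s) ⟩

  line-states : ∀ o n (t b : Fin n → ℕ) →
    ∏ (λ p → ⟨ junction n (mark o) (mark o) t b p ≡ᵇ 1 ⟩) ≈
    ∑ (vectors bits (suc n)) (λ s → boundary o s *
      ∏ (λ i → arrows o (lookup s (inject₁ i)) (lookup s (suc i)) (t i) (b i)))
  line-states o n t b = trans (junction-states o n (mark o) (mark o) t b)
    (Sum.fold-cong (vectors bits (suc n)) λ s →
      trans (*-congˡ (*-comm _ _)) (sym (*-assoc _ _ _)))

  grid-states : ∀ o m n (t b : Fin m → Fin n → ℕ) →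
    ∏ (λ j → ∏ (λ p → ⟨ junction n (mark o) (mark o) (t j) (b j) p ≡ᵇ 1 ⟩)) ≈
    ∑ (vectors (vectors bits (suc n)) m) (λ S → ∏ (λ j → boundary o (lookup S j)) *
      ∏ (λ j → ∏ (λ i → arrows o (lookup (lookup S j) (inject₁ i)) (lookup (lookup S j) (suc i))
        (t j i) (b j i))))
  grid-states o m n t b = begin
    _ ≈⟨ ∏.sum-cong-≋ (λ j → line-states o n (t j) (b j)) ⟩
    _ ≈⟨ ∏-∑ m (vectors bits (suc n)) _ ⟩
    _ ≈⟨ Sum.fold-cong (vectors (vectors bits (suc n)) m) (λ S →
           ∏.∑-distrib-+ (λ j → boundary o (lookup S j)) _) ⟩
    _ ∎

  cellFactor : Bool → Bool → Bool → Bool → Bool → List Corner → Carrier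
  cellFactor o s s′ h h′ ks =
    arrows o s s′ (count proj₁ 0F ks) (count proj₁ 1F ks) *
    arrows o h h′ (count proj₂ 0F ks) (count proj₂ 1F ks)

  cellSum : Bool → (Corner → Carrier) → Bool → Bool → Bool → Bool → Carrier
  cellSum o w s s′ h h′ = ∑ (subsets corners) (λ ks → ∏ᴸ ks w * cellFactor o s s′ h h′ ks)

  States : ℕ → Set
  States n = Vec (Vec Bool (suc n)) n

  states : ∀ n → List (States n)
  states n = vectors (vectors bits (suc n)) n

  boundaries : Bool → States n → Carrier
  boundaries o S = ∏ (λ i → boundary o (lookup S i))

  atCell : ∀ {X : Set a} → (Bool → Bool → Bool → Bool → X) → States n → Vec Bool (suc n) → Fin n → Fin n → X
  atCell f S h i j = f (lookup (lookup S j) (inject₁ i)) (lookup (lookup S j) (suc i))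
                       (lookup h (inject₁ j)) (lookup h (suc j))

  -- Once the bits are fixed, the degree conditions see `es` only cell by cell, so exchanging the
  -- sums allows `factorise`. The vertices `u` form a line for each column of cells and the vertices
  -- `v` one for each row; accordingly `S` is indexed by `j` and `H` by `i`.
  Z-cellGraph : ∀ o n w → Z (cellGraph n) (external (mark o)) w ≈
    ∑ (states n) (λ S → ∑ (states n) (λ H → (boundaries o S * boundaries o H) *
      ∏ (λ i → ∏ (λ j → atCell (cellSum o (λ k → w ((i , j) , k))) S (lookup H i) i j))))
  Z-cellGraph o n w = begin
    ∑ Es (λ es → ∏ᴸ es w * ∏ᴸ (Graph.vertices (AD n)) (δ es))
      ≈⟨ Sum.fold-cong Es (λ es → *-congˡ (vertices-split es)) ⟩
    ∑ Es (λ es → ∏ᴸ es w * (∏ (λ j → ∏ (λ p → δ es (u p j))) * ∏ (λ i → ∏ (λ q → δ es (v i q)))))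
      ≈⟨ Sum.fold-cong Es (λ es → *-congˡ (*-cong
           (trans (∏.sum-cong-≋ λ j → ∏.sum-cong-≋ λ p →
                    reflexive (cong (λ d → ⟨ d ≡ᵇ 1 ⟩) (degree-u (mark o) p j es)))
                  (grid-states o n n _ _))
           (trans (∏.sum-cong-≋ λ i → ∏.sum-cong-≋ λ q →
                    reflexive (cong (λ d → ⟨ d ≡ᵇ 1 ⟩) (degree-v (mark o) i q es)))
                  (grid-states o n n _ _)))) ⟩
    ∑ Es (λ es → ∏ᴸ es w *
      (∑ Ss (λ S → boundaries o S * uFactors S es) * ∑ Ss (λ H → boundaries o H * vFactors H es)))
      ≈⟨ Sum.fold-cong Es (λ es → trans (*-congˡ (∑-* Ss Ss _ _))
           (trans (∑-distribˡ _ Ss _) (Sum.fold-cong Ss λ S → trans (∑-distribˡ _ Ss _)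
             (Sum.fold-cong Ss λ H → collect es S H)))) ⟩
    ∑ Es (λ es → ∑ Ss (λ S → ∑ Ss (λ H → (boundaries o S * boundaries o H) *
      (∏ᴸ es w * ∏ᴸ (cells n) (λ c → factor S H c (es at c))))))
      ≈⟨ trans (Sum.fold-comm Es Ss _) (Sum.fold-cong Ss λ S → Sum.fold-comm Es Ss _) ⟩
    ∑ Ss (λ S → ∑ Ss (λ H → ∑ Es (λ es → (boundaries o S * boundaries o H) *
      (∏ᴸ es w * ∏ᴸ (cells n) (λ c → factor S H c (es at c))))))
      ≈⟨ Sum.fold-cong Ss (λ S → Sum.fold-cong Ss λ H → trans (sym (∑-distribˡ _ Es _))
           (*-congˡ (trans (factorise corners w (factor S H) cells-unique) (∏ᴸ-cells n n _)))) ⟩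
    _ ∎
    where
    Es = subsets (Graph.edges (cellGraph n))
    Ss = states n
    cells-unique = Unique.cartesianProduct⁺ (Unique.allFin⁺ n) (Unique.allFin⁺ n)

    δ : List (Cell n × Corner) → AztecVertex n → Carrier
    δ es p = ⟨ external (mark o) p ℕ.+ degree (cellGraph n) p es ≡ᵇ 1 ⟩

    uFactor vFactor : States n → List (Cell n × Corner) → Fin n → Fin n → Carrier
    uFactor S es i j = arrows o (lookup (lookup S j) (inject₁ i)) (lookup (lookup S j) (suc i))
      (count proj₁ 0F (es at (i , j))) (count proj₁ 1F (es at (i , j)))
    vFactor H es i j = arrows o (lookup (lookup H i) (inject₁ j)) (lookup (lookup H i) (suc j))
      (count proj₂ 0F (es at (i , j))) (count proj₂ 1F (es at (i , j)))

    uFactors vFactors : States n → List (Cell n × Corner) → Carrier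
    uFactors S es = ∏ (λ j → ∏ (λ i → uFactor S es i j))
    vFactors H es = ∏ (λ i → ∏ (λ j → vFactor H es i j))

    factor : States n → States n → Cell n → List Corner → Carrier
    factor S H (i , j) = atCell (cellFactor o) S (lookup H i) i j

    vertices-split : ∀ es → ∏ᴸ (Graph.vertices (AD n)) (δ es) ≈
      ∏ (λ j → ∏ (λ p → δ es (u p j))) * ∏ (λ i → ∏ (λ q → δ es (v i q)))
    vertices-split es = trans (Product.fold-++ (map inj₁ us) (map inj₂ vs) (δ es))
      (*-cong
        (trans (reflexive (Product.fold-map inj₁ us (δ es)))
          (trans (∏ᴸ-cells (suc n) n _) (∏.∑-comm (λ p j → δ es (u p j)))))
        (trans (reflexive (Product.fold-map inj₂ vs (δ es))) (∏ᴸ-cells n (suc n) _)))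
      where
      us = cartesianProduct (allFin (suc n)) (allFin n)
      vs = cartesianProduct (allFin n) (allFin (suc n))

    collect : ∀ es S H →
      ∏ᴸ es w * ((boundaries o S * uFactors S es) * (boundaries o H * vFactors H es)) ≈
      (boundaries o S * boundaries o H) * (∏ᴸ es w * ∏ᴸ (cells n) (λ c → factor S H c (es at c)))
    collect es S H = begin
      _ ≈⟨ *-congˡ (interchange _ _ _ _) ⟩
      _ ≈⟨ x∙yz≈y∙xz _ _ _ ⟩
      _ ≈⟨ *-congˡ (*-congˡ (*-congʳ (∏.∑-comm (λ j i → uFactor S es i j)))) ⟩
      _ ≈⟨ *-congˡ (*-congˡ (∏.∑-distrib-+ (λ i → ∏ (uFactor S es i)) (λ i → ∏ (vFactor H es i)))) ⟨
      _ ≈⟨ *-congˡ (*-congˡ (∏.sum-cong-≋ λ i → ∏.∑-distrib-+ (uFactor S es i) (vFactor H es i))) ⟨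
      _ ≈⟨ *-congˡ (*-congˡ (∏ᴸ-cells n n (λ c → factor S H c (es at c)))) ⟨
      _ ∎

  -- Urban renewal in a single cell

  fits : Bool → Bool → Bool → Bool → Bool → List Corner → Bool
  fits o s s′ h h′ ks =
    ((count proj₁ 0F ks ≡ᵇ inCell o s) ∧ (count proj₁ 1F ks ≡ᵇ inCell o (not s′))) ∧
    ((count proj₂ 0F ks ≡ᵇ inCell o h) ∧ (count proj₂ 1F ks ≡ᵇ inCell o (not h′)))

  ∑-filterᵇ : ∀ (κ : A → Bool) xs f → ∑ xs (λ x → f x * ⟨ κ x ⟩) ≈ ∑ (filterᵇ κ xs) f
  ∑-filterᵇ κ []       f = refl
  ∑-filterᵇ κ (x ∷ xs) f with κ x
  ... | true  = +-cong (*-identityʳ _) (∑-filterᵇ κ xs f)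
  ... | false = trans (+-cong (zeroʳ _) (∑-filterᵇ κ xs f)) (+-identityˡ _)

  cellFactor-fits : ∀ o s s′ h h′ ks → cellFactor o s s′ h h′ ks ≈ ⟨ fits o s s′ h h′ ks ⟩
  cellFactor-fits o s s′ h h′ ks = sym (trans
    (⟨⟩-∧ ((count proj₁ 0F ks ≡ᵇ inCell o s) ∧ (count proj₁ 1F ks ≡ᵇ inCell o (not s′))) _)
    (*-cong (⟨⟩-∧ (count proj₁ 0F ks ≡ᵇ inCell o s) _)
            (⟨⟩-∧ (count proj₂ 0F ks ≡ᵇ inCell o h) _)))

  -- Products of indicators do not reduce in an abstract ring. With a Boolean test, `filterᵇ`
  -- evaluates on the sixteen sets of corners as soon as the four bits are concrete.
  cellSum-fits : ∀ o w s s′ h h′ →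
    cellSum o w s s′ h h′ ≈ ∑ (filterᵇ (fits o s s′ h h′) (subsets corners)) (λ ks → ∏ᴸ ks w)
  cellSum-fits o w s s′ h h′ = trans
    (Sum.fold-cong (subsets corners) (λ ks → *-congˡ {∏ᴸ ks w} (cellFactor-fits o s s′ h h′ ks)))
    (∑-filterᵇ (fits o s s′ h h′) (subsets corners) (λ ks → ∏ᴸ ks w))

  -- A permanent, in spite of the name: the sum over the two perfect matchings of the 4-cycle.
  det : (Corner → Carrier) → Carrier
  det w = w (0F , 0F) * w (1F , 1F) + w (1F , 0F) * w (0F , 1F)

  -- Complemented bits turn a cell with a single edge into one whose edge joins the other two
  -- vertices, that is, the opposite edge.
  dual : Carrier → (Corner → Carrier) → Corner → Carrier
  dual σ w (a , b) = σ * w (opp a , opp b)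

  -- The hypotheses are named after the values of `h` and `h′`. They say that, with c = `g′ true`,
  -- the values at `true` and `false` are c and cσ·det for `g′`, and cσ and cσ²·det for `g`.
  module _ (w : Corner → Carrier) (σ : Carrier) (g g′ : Bool → Carrier)
    (true-false  : g true * det w ≈ g′ false)
    (false-false : g false ≈ g′ false * σ)
    (true-true   : g true ≈ g′ true * σ)
    (false-true  : g false ≈ g′ true * (σ * σ * det w)) where

    private
      none : g′ false * 1# ≈ g′ false * (1# + 0#)
      none = *-congˡ (sym (+-identityʳ 1#))

      single : ∀ {x y z} → x ≈ y * σ → x * (z * 1# + 0#) ≈ y * ((σ * z) * 1# + 0#)
      single {x} {y} {z} eq = begin
        x * (z * 1# + 0#)       ≈⟨ *-cong eq (trans (+-identityʳ _) (*-identityʳ z)) ⟩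
        (y * σ) * z             ≈⟨ *-assoc y σ z ⟩
        y * (σ * z)             ≈⟨ *-congˡ (trans (+-identityʳ _) (*-identityʳ _)) ⟨
        y * ((σ * z) * 1# + 0#) ∎

      vanish : ∀ {x y} → x * 0# ≈ y * 0#
      vanish = trans (zeroʳ _) (sym (zeroʳ _))

      two : ∀ (w : Corner → Carrier) →
        w (0F , 0F) * (w (1F , 1F) * 1#) + (w (0F , 1F) * (w (1F , 0F) * 1#) + 0#) ≈ det w
      two w = +-cong (*-congˡ (*-identityʳ _))
        (trans (+-identityʳ _) (trans (*-congˡ (*-identityʳ _)) (*-comm _ _)))

      det-dual : det (dual σ w) ≈ σ * σ * det w
      det-dual = begin
        _ ≈⟨ +-cong (interchange σ _ σ _) (interchange σ _ σ _) ⟩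
        _ ≈⟨ distribˡ (σ * σ) _ _ ⟨
        _ ≈⟨ *-congˡ (+-cong (*-comm _ _) (*-comm _ _)) ⟩
        σ * σ * det w ∎

      -- The edges of a cell have as many ends among the `u` as among the `v`, which leaves the six
      -- configurations of the ice rule. In the other ten cases both lists are empty.
      renewal-fits : ∀ s s′ h h′ →
        g h * ∑ (filterᵇ (fits false s s′ h h′) (subsets corners)) (λ ks → ∏ᴸ ks w) ≈
        g′ h′ * ∑ (filterᵇ (fits true s s′ h h′) (subsets corners)) (λ ks → ∏ᴸ ks (dual σ w))
      renewal-fits true  false true  false = trans (*-congˡ (two w)) (trans true-false
        (sym (trans (*-congˡ (+-identityʳ 1#)) (*-identityʳ _))))
      renewal-fits false true  false true  = begin
        g false * (1# + 0#)             ≈⟨ trans (*-congˡ (+-identityʳ 1#)) (*-identityʳ _) ⟩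
        g false                         ≈⟨ false-true ⟩
        g′ true * (σ * σ * det w)       ≈⟨ *-congˡ (trans (two (dual σ w)) det-dual) ⟨
        _ ∎
      renewal-fits true  true  true  true  = single true-true
      renewal-fits true  true  false false = single false-false
      renewal-fits false false true  true  = single true-true
      renewal-fits false false false false = single false-false
      renewal-fits true  true  true  false = vanish
      renewal-fits true  true  false true  = vanish
      renewal-fits false false true  false = vanish
      renewal-fits false false false true  = vanish
      renewal-fits true  false true  true  = vanish
      renewal-fits true  false false false = vanish
      renewal-fits true  false false true  = vanish
      renewal-fits false true  true  true  = vanish
      renewal-fits false true  true  false = vanish
      renewal-fits false true  false false = vanish

    renewal : ∀ s s′ h h′ →
      g h * cellSum false w s s′ h h′ ≈ g′ h′ * cellSum true (dual σ w) s s′ h h′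
    renewal s s′ h h′ = trans (*-congˡ (cellSum-fits false w s s′ h h′))
      (trans (renewal-fits s s′ h h′) (*-congˡ (sym (cellSum-fits true (dual σ w) s s′ h h′))))

  -- Telescoping along a row of cells

  telescope : ∀ n (g : Fin (suc n) → Carrier) (f f′ : Fin n → Carrier) →
    (∀ i → g (inject₁ i) * f i ≈ g (suc i) * f′ i) → g zero * ∏ f ≈ g (fromℕ n) * ∏ f′
  telescope zero    g f f′ step = refl
  telescope (suc n) g f f′ step = begin
    g zero * (f zero * ∏ (f ∘ suc))           ≈⟨ *-assoc _ _ _ ⟨
    (g zero * f zero) * ∏ (f ∘ suc)           ≈⟨ *-congʳ (step zero) ⟩
    (g (suc zero) * f′ zero) * ∏ (f ∘ suc)    ≈⟨ trans (*-congʳ (*-comm _ _)) (*-assoc _ _ _) ⟩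
    f′ zero * (g (suc zero) * ∏ (f ∘ suc))    ≈⟨ *-congˡ (telescope n (g ∘ suc) _ _ (step ∘ suc)) ⟩
    f′ zero * (g (fromℕ (suc n)) * ∏ (f′ ∘ suc)) ≈⟨ x∙yz≈y∙xz _ _ _ ⟩
    g (fromℕ (suc n)) * (f′ zero * ∏ (f′ ∘ suc)) ∎

  boundary-polarity : ∀ (s : Vec Bool (suc n)) → boundary false s ≈ boundary true s
  boundary-polarity {n} s with first s | last s
  ... | true  | true  = refl
  ... | true  | false = refl
  ... | false | true  = refl
  ... | false | false = refl

  annihilate : ∀ {x y z t} → x ≈ 0# → x * y ≈ z * (x * t)
  annihilate x≈0 = trans (trans (*-congʳ x≈0) (zeroˡ _))
    (sym (trans (*-congˡ (trans (*-congʳ x≈0) (zeroˡ _))) (zeroʳ _)))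

  -- Only bits running from `true` to `false` survive the boundary condition; for all others both
  -- sides vanish. So the gauge is evaluated at `true` on the left end and at `false` on the right
  -- end.
  telescope-boundary : ∀ n (g : Fin (suc n) → Bool → Carrier) (s : Vec Bool (suc n)) (f f′ : Fin n → Carrier) →
    (∀ i → g (inject₁ i) (lookup s (inject₁ i)) * f i ≈ g (suc i) (lookup s (suc i)) * f′ i) →
    g zero true ≈ 1# → boundary false s * ∏ f ≈ g (fromℕ n) false * (boundary true s * ∏ f′)
  telescope-boundary n g s f f′ step g≈1
    with first s | last s | telescope n (λ i → g i (lookup s i)) f f′ step
  ... | true  | false | eq = begin
    (1# * 1#) * ∏ f                          ≈⟨ *-congʳ (*-identityʳ 1#) ⟩
    1# * ∏ f                                 ≈⟨ *-congʳ g≈1 ⟨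
    g zero true * ∏ f                        ≈⟨ eq ⟩
    g (fromℕ n) false * ∏ f′                 ≈⟨ *-congˡ (trans (*-congʳ (*-identityʳ 1#)) (*-identityˡ _)) ⟨
    g (fromℕ n) false * ((1# * 1#) * ∏ f′)   ∎
  ... | true  | true  | _ = annihilate (zeroʳ 1#)
  ... | false | true  | _ = annihilate (zeroʳ 0#)
  ... | false | false | _ = annihilate (zeroˡ 1#)

  -- The weights of the theorem and their gauge

  inverseʳ : ∀ a → ⟦ a ⟧ * ⟦ a ⁻¹ ⟧ ≈ 1#
  inverseʳ (_ , _ , _ , q) = q

  inverseˡ : ∀ a → ⟦ a ⁻¹ ⟧ * ⟦ a ⟧ ≈ 1#
  inverseˡ (_ , _ , p , _) = p

  cancelʳ : ∀ z a → z * ⟦ a ⁻¹ ⟧ * ⟦ a ⟧ ≈ z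
  cancelʳ z a = trans (*-assoc _ _ _) (trans (*-congˡ (inverseˡ a)) (*-identityʳ z))

  entry : Parity → Fin 2 → Unit × Unit → Unit
  entry 0ℙ 0F (a , b) = a
  entry 0ℙ 1F (a , b) = b
  entry 1ℙ 0F (a , b) = a ⁻¹
  entry 1ℙ 1F (a , b) = b ⁻¹

  yWeight-entry : ∀ n T r s {j b} → remQuot {n} 2 s ≡ (j , b) →
    yWeight n T (r , s) ≡ entry (parity (toℕ j)) b (T r)
  yWeight-entry n T r s {j} {b} eq with suc (toℕ s) mod 4 | columnType-remQuot n s eq
  ... | _ | ≡.refl with parity (toℕ j) | b
  ...   | 0ℙ | 0F = ≡.refl
  ...   | 0ℙ | 1F = ≡.refl
  ...   | 1ℙ | 0F = ≡.refl
  ...   | 1ℙ | 1F = ≡.refl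

  blockWeight : Matrix n → Parity → Fin n → Corner → Carrier
  blockWeight T p i (a , b) = ⟦ entry p b (T (combine i a)) ⟧

  cellWeight : Matrix n → Cell n × Corner → Carrier
  cellWeight T ((i , j) , k) = blockWeight T (parity (toℕ j)) i k

  twist : Parity → Unit → Unit
  twist 0ℙ S = S ⁻¹
  twist 1ℙ S = S

  dualWeight : Matrix n → (Fin n → Unit) → Cell n × Corner → Carrier
  dualWeight T S ((i , j) , k) = dual ⟦ twist p (S i) ⟧ (blockWeight T p i) k
    where p = parity (toℕ j)

  -- The solution of the hypotheses of `renewal` in both parities, normalised to 1 at the left end
  -- of a row. Here `d` stands for Δ, and the value at `false` is always d / S times the value at
  -- `true`.
  gauge : Parity → Carrier → Unit → Bool → Carrier
  gauge 0ℙ d S false = d * ⟦ S ⁻¹ ⟧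
  gauge 0ℙ d S true  = 1#
  gauge 1ℙ d S false = d
  gauge 1ℙ d S true  = ⟦ S ⟧

  IsRoots : Matrix n → (Fin n → Unit) → Set ℓ
  IsRoots {n} T S = ∀ (i : Fin n) → ⟦ S i ⟧ * ⟦ S i ⟧ ≈
    (⟦ x T (odd i) ⟧ * ⟦ y T (even i) ⟧) * (⟦ x T (even i) ⟧ * ⟦ y T (odd i) ⟧)

  det-inverse : ∀ a b c d → (⟦ a ⟧ * ⟦ b ⟧) * (⟦ c ⟧ * ⟦ d ⟧) * (⟦ a ⁻¹ ⟧ * ⟦ b ⁻¹ ⟧ + ⟦ c ⁻¹ ⟧ * ⟦ d ⁻¹ ⟧) ≈
    ⟦ a ⟧ * ⟦ b ⟧ + ⟦ c ⟧ * ⟦ d ⟧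
  det-inverse a b c d = begin
    ab * cd * (⟦ (a · b) ⁻¹ ⟧ + ⟦ (c · d) ⁻¹ ⟧)
      ≈⟨ distribˡ _ _ _ ⟩
    ab * cd * ⟦ (a · b) ⁻¹ ⟧ + ab * cd * ⟦ (c · d) ⁻¹ ⟧
      ≈⟨ +-cong (trans (*-congʳ (*-comm ab cd)) (cancel cd (a · b))) (cancel ab (c · d)) ⟩
    cd + ab
      ≈⟨ +-comm cd ab ⟩
    ab + cd ∎
    where
    ab = ⟦ a · b ⟧
    cd = ⟦ c · d ⟧
    cancel : ∀ z e → z * ⟦ e ⟧ * ⟦ e ⁻¹ ⟧ ≈ z
    cancel z e = cancelʳ z (e ⁻¹)

  module _ (n : ℕ) (T : Matrix n) (S : Fin n → Unit) (roots : IsRoots T S) where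

    renewal-cell : ∀ p i s s′ h h′ →
      gauge p (Δ n T i) (S i) h * cellSum false (blockWeight T p i) s s′ h h′ ≈
      gauge (flip p) (Δ n T i) (S i) h′ * cellSum true (dual ⟦ twist p (S i) ⟧ (blockWeight T p i)) s s′ h h′
    renewal-cell 0ℙ i = renewal (blockWeight T 0ℙ i) ⟦ S i ⁻¹ ⟧ _ _
      (*-identityˡ _) refl (sym (inverseʳ (S i))) (begin
        Δ n T i * ⟦ S i ⁻¹ ⟧                           ≈⟨ *-comm _ _ ⟩
        ⟦ S i ⁻¹ ⟧ * Δ n T i                           ≈⟨ *-congʳ (trans (*-congʳ (inverseʳ (S i))) (*-identityˡ _)) ⟨
        ⟦ S i ⟧ * ⟦ S i ⁻¹ ⟧ * ⟦ S i ⁻¹ ⟧ * Δ n T i      ≈⟨ *-congʳ (*-assoc _ _ _) ⟩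
        ⟦ S i ⟧ * (⟦ S i ⁻¹ ⟧ * ⟦ S i ⁻¹ ⟧) * Δ n T i    ≈⟨ *-assoc _ _ _ ⟩
        ⟦ S i ⟧ * (⟦ S i ⁻¹ ⟧ * ⟦ S i ⁻¹ ⟧ * Δ n T i)    ∎)
    renewal-cell 1ℙ i = renewal (blockWeight T 1ℙ i) ⟦ S i ⟧ _ _
      (begin
        ⟦ S i ⟧ * d′                         ≈⟨ cancelʳ _ (S i ⁻¹) ⟨
        ⟦ S i ⟧ * d′ * ⟦ S i ⟧ * ⟦ S i ⁻¹ ⟧    ≈⟨ *-congʳ (trans (*-comm _ _) (sym (*-assoc _ _ _))) ⟩
        ⟦ S i ⟧ * ⟦ S i ⟧ * d′ * ⟦ S i ⁻¹ ⟧    ≈⟨ *-congʳ S²d′≈Δ ⟩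
        Δ n T i * ⟦ S i ⁻¹ ⟧                 ∎)
      (sym (cancelʳ _ (S i)))
      (sym (*-identityˡ _))
      (sym (trans (*-identityˡ _) S²d′≈Δ))
      where
      d′ = det (blockWeight T 1ℙ i)

      S²d′≈Δ : ⟦ S i ⟧ * ⟦ S i ⟧ * d′ ≈ Δ n T i
      S²d′≈Δ = trans (*-congʳ (roots i)) (det-inverse (x T (odd i)) (y T (even i)) (x T (even i)) (y T (odd i)))

    rowFactor : Fin n → Carrier
    rowFactor i = gauge (parity n) (Δ n T i) (S i) false

    renewal-row : ∀ i (P : States n) h →
      boundary false h * ∏ (λ j → atCell (cellSum false (λ k → cellWeight T ((i , j) , k))) P h i j) ≈
      rowFactor i * (boundary true h *
        ∏ (λ j → atCell (cellSum true (λ k → dualWeight T S ((i , j) , k))) P h i j))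
    renewal-row i P h = trans
      (telescope-boundary n g h _ _ step refl)
      (*-congʳ (reflexive (cong (λ k → gauge (parity k) (Δ n T i) (S i) false) (Fin.toℕ-fromℕ n))))
      where
      g : Fin (suc n) → Bool → Carrier
      g j = gauge (parity (toℕ j)) (Δ n T i) (S i)

      step : ∀ j → g (inject₁ j) (lookup h (inject₁ j)) * _ ≈ g (suc j) (lookup h (suc j)) * _
      -- Both vertices of the cell get their gauge in terms of the parity of its own column, flipped
      -- at the right vertex.
      step j rewrite Fin.toℕ-inject₁ j | parity-suc (toℕ j) =
        renewal-cell (parity (toℕ j)) i (lookup (lookup P j) (inject₁ i)) (lookup (lookup P j) (suc i))
          (lookup h (inject₁ j)) (lookup h (suc j))

    -- The gauge depends on the bits `H` alone, so it is moved along rows only; for the bits `P` it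
    -- suffices that the boundary condition is the same in both graphs.
    renewal-states : ∀ P H →
      (boundaries false P * boundaries false H) *
        ∏ (λ i → ∏ (λ j → atCell (cellSum false (λ k → cellWeight T ((i , j) , k))) P (lookup H i) i j)) ≈
      ∏ rowFactor * ((boundaries true P * boundaries true H) *
        ∏ (λ i → ∏ (λ j → atCell (cellSum true (λ k → dualWeight T S ((i , j) , k))) P (lookup H i) i j)))
    renewal-states P H = begin
      (boundaries false P * boundaries false H) * ∏ F
        ≈⟨ *-assoc _ _ _ ⟩
      boundaries false P * (boundaries false H * ∏ F)
        ≈⟨ *-cong (∏.sum-cong-≋ λ j → boundary-polarity (lookup P j)) rows ⟩
      boundaries true P * (∏ rowFactor * (boundaries true H * ∏ F′))
        ≈⟨ x∙yz≈y∙xz _ _ _ ⟩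
      ∏ rowFactor * (boundaries true P * (boundaries true H * ∏ F′))
        ≈⟨ *-congˡ (*-assoc _ _ _) ⟨
      ∏ rowFactor * ((boundaries true P * boundaries true H) * ∏ F′) ∎
      where
      F F′ : Fin n → Carrier
      F i = ∏ (λ j → atCell (cellSum false (λ k → cellWeight T ((i , j) , k))) P (lookup H i) i j)
      F′ i = ∏ (λ j → atCell (cellSum true (λ k → dualWeight T S ((i , j) , k))) P (lookup H i) i j)

      rows : boundaries false H * ∏ F ≈ ∏ rowFactor * (boundaries true H * ∏ F′)
      rows = begin
        boundaries false H * ∏ F
          ≈⟨ ∏.∑-distrib-+ (boundary false ∘ lookup H) F ⟨
        ∏ (λ i → boundary false (lookup H i) * F i)
          ≈⟨ ∏.sum-cong-≋ (λ i → renewal-row i P (lookup H i)) ⟩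
        ∏ (λ i → rowFactor i * (boundary true (lookup H i) * F′ i))
          ≈⟨ ∏.∑-distrib-+ rowFactor _ ⟩
        ∏ rowFactor * ∏ (λ i → boundary true (lookup H i) * F′ i)
          ≈⟨ *-congˡ (∏.∑-distrib-+ (boundary true ∘ lookup H) F′) ⟩
        ∏ rowFactor * (boundaries true H * ∏ F′) ∎

    Z-renewal : Z (cellGraph n) (external 0) (cellWeight T) ≈
      ∏ rowFactor * Z (cellGraph n) (external 1) (dualWeight T S)
    Z-renewal = begin
      Z (cellGraph n) (external 0) (cellWeight T)
        ≈⟨ Z-cellGraph false n (cellWeight T) ⟩
      _ ≈⟨ Sum.fold-cong (states n) (λ P → Sum.fold-cong (states n) (renewal-states P)) ⟩
      _ ≈⟨ trans (∑-distribˡ _ (states n) _) (Sum.fold-cong (states n) λ P → ∑-distribˡ _ (states n) _) ⟨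
      _ ≈⟨ *-congˡ (Z-cellGraph true n (dualWeight T S)) ⟨
      ∏ rowFactor * Z (cellGraph n) (external 1) (dualWeight T S) ∎

  -- The dual weights as the weights of r(T)

  r-row : ∀ m S T s {k a} → remQuot {m} 2 s ≡ (k , a) → let κ = shift k a; ρ = combine κ a in
    r m S T s ≡ (x T ρ ÷ S κ , S κ ÷ y T ρ)
  r-row m S T s eq with remQuot {m} 2 s
  r-row m S T s ≡.refl | k , 0F = ≡.refl
  r-row m S T s ≡.refl | k , 1F = ≡.refl

  -- For `b` = 0 the column keeps its parity and gives x / S or its inverse. For `b` = 1 the edge
  -- lies in the next cell, of opposite parity: y becomes inverted and σ changes from 1 / S to S, or
  -- the other way round. Hence the reciprocal form S / y of the second entry.
  dual-entry : ∀ (l : Fin m) b a d S → let p = parity (toℕ (shift l b)) in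
    ⟦ twist p S ⟧ * ⟦ entry p (opp (opp b)) (a , d) ⟧ ≈ ⟦ entry (parity (toℕ l)) b (a ÷ S , S ÷ d) ⟧
  dual-entry l 0F a d S rewrite Fin.toℕ-inject₁ l with parity (toℕ l)
  ... | 0ℙ = *-comm _ _
  ... | 1ℙ = *-comm _ _
  dual-entry l 1F a d S rewrite parity-suc (toℕ l) with parity (toℕ l)
  ... | 0ℙ = refl
  ... | 1ℙ = refl

  M-whole : ∀ n T → M (AD n) (yWeight n T) ≈ Z (cellGraph n) (external 0) (cellWeight T)
  M-whole n T = trans (M≈Z (AD n) (yWeight n T)) (Z-embedding (whole n) λ (r , s) →
    reflexive (≡.trans
      (cong (λ r → ⟦ entry (parity (toℕ (proj₁ (remQuot {n} 2 s)))) (proj₂ (remQuot {n} 2 s)) (T r) ⟧)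
        (Fin.combine-remQuot {n} 2 r))
      (≡.sym (cong ⟦_⟧ (yWeight-entry n T r s ≡.refl)))))

  -- The `opp` of `halfStep` and that of `dual` cancel: an edge in half `a` of row pair `k` takes
  -- its weight from row `a` of the pair `shift k a`. This is why r(T) uses the rows 2k-1 and 2k+2
  -- of T.
  M-inner : ∀ m T S → M (AD m) (yWeight m (r m S T)) ≈ Z (cellGraph (suc m)) (external 1) (dualWeight T S)
  M-inner m T S = trans (M≈Z (AD m) (yWeight m (r m S T))) (Z-embedding (inner m) λ (q , s) →
    weights (proj₁ (remQuot {m} 2 q)) _ q s ≡.refl ≡.refl)
    where
    weights : ∀ k a q s {l b} → remQuot {m} 2 q ≡ (k , a) → remQuot {m} 2 s ≡ (l , b) →
      dualWeight T S (cellEdge (halfStep (k , a)) (halfStep (l , b))) ≈ ⟦ yWeight m (r m S T) (q , s) ⟧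
    weights k a q s {l} {b} eq eq′ = begin
      ⟦ twist p (S κ) ⟧ * ⟦ entry p (opp (opp b)) (T (combine κ (opp (opp a)))) ⟧
        ≡⟨ cong (λ a → ⟦ twist p (S κ) ⟧ * ⟦ entry p (opp (opp b)) (T (combine κ a)) ⟧) (opp-involutive a) ⟩
      ⟦ twist p (S κ) ⟧ * ⟦ entry p (opp (opp b)) (T (combine κ a)) ⟧
        ≈⟨ dual-entry l b (x T (combine κ a)) (y T (combine κ a)) (S κ) ⟩
      ⟦ entry (parity (toℕ l)) b (x T (combine κ a) ÷ S κ , S κ ÷ y T (combine κ a)) ⟧
        ≡⟨ cong (λ row → ⟦ entry (parity (toℕ l)) b row ⟧) (r-row m S T q eq) ⟨
      ⟦ entry (parity (toℕ l)) b (r m S T q) ⟧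
        ≡⟨ cong ⟦_⟧ (yWeight-entry m (r m S T) q s eq′) ⟨
      ⟦ yWeight m (r m S T) (q , s) ⟧ ∎
      where
      κ = shift k a
      p = parity (toℕ (shift l b))

  reduction : ∀ m T S → IsRoots T S → M (AD (suc m)) (yWeight (suc m) T) ≈
    M (AD m) (yWeight m (r m S T)) * ∏ (λ i → gauge (parity (suc m)) (Δ (suc m) T i) (S i) false)
  reduction m T S roots = begin
    M (AD (suc m)) (yWeight (suc m) T)
      ≈⟨ M-whole (suc m) T ⟩
    Z (cellGraph (suc m)) (external 0) (cellWeight T)
      ≈⟨ Z-renewal (suc m) T S roots ⟩
    ∏ (rowFactor (suc m) T S roots) * Z (cellGraph (suc m)) (external 1) (dualWeight T S)
      ≈⟨ *-comm _ _ ⟩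
    Z (cellGraph (suc m)) (external 1) (dualWeight T S) * ∏ (rowFactor (suc m) T S roots)
      ≈⟨ *-congʳ (M-inner m T S) ⟨
    _ ∎

  isRoots : ∀ n ξ η → IsRoots (squares n ξ η) (roots n ξ η)
  isRoots n ξ η i = begin
    (α * β * γ * δ) * (α * β * γ * δ)
      ≈⟨ interchange _ _ _ _ ⟩
    ((α * β * γ) * (α * β * γ)) * (δ * δ)
      ≈⟨ *-congʳ (interchange _ _ _ _) ⟩
    (((α * β) * (α * β)) * (γ * γ)) * (δ * δ)
      ≈⟨ *-congʳ (*-congʳ (interchange _ _ _ _)) ⟩
    (((α * α) * (β * β)) * (γ * γ)) * (δ * δ)
      ≈⟨ trans (*-congʳ (*-assoc _ _ _)) (trans (*-assoc _ _ _) (*-congˡ (*-comm _ _))) ⟩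
    (α * α) * ((δ * δ) * ((β * β) * (γ * γ)))
      ≈⟨ *-assoc _ _ _ ⟨
    ((α * α) * (δ * δ)) * ((β * β) * (γ * γ))
      ≈⟨ *-congˡ (*-comm _ _) ⟩
    ((α * α) * (δ * δ)) * ((γ * γ) * (β * β)) ∎
    where
    α = ⟦ ξ (odd i) ⟧
    β = ⟦ η (odd i) ⟧
    γ = ⟦ ξ (even i) ⟧
    δ = ⟦ η (even i) ⟧

theorem4p1 : ∀ {c ℓ} (R : CommutativeRing c ℓ) →
    let open CommutativeRing R
        open Weights R
    in
    (m : ℕ.ℕ) →
    let n = ℕ.suc m in
    (ξ η : Fin (n ℕ.* 2) → Unit) →
    let T = squares n ξ η
        S = roots n ξ η
    in
    (2 ∣ n → M (AD n) (yWeight n T) ≈ M (AD m) (yWeight m (r m S T)) * ∏ (λ i → Δ n T i * ⟦ S i ⁻¹ ⟧)) ×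
    (2 ∤ n → M (AD n) (yWeight n T) ≈ M (AD m) (yWeight m (r m S T)) * ∏ (λ i → Δ n T i))
theorem4p1 R m ξ η = (λ 2∣n → at-parity (2∣⇒parity≡0 2∣n)) , (λ 2∤n → at-parity (2∤⇒parity≡1 2∤n))
  where
  open CommutativeRing R
  open Weights R
  open Reduction R
  T = squares (suc m) ξ η
  S = roots (suc m) ξ η

  -- With the parity as a variable, `gauge p` reduces to Δ / S or to Δ once `p` is known.
  at-parity : ∀ {p} → parity (suc m) ≡ p →
    M (AD (suc m)) (yWeight (suc m) T) ≈
    M (AD m) (yWeight m (r m S T)) * ∏ (λ i → gauge p (Δ (suc m) T i) (S i) false)
  at-parity ≡.refl = reduction m T S (isRoots (suc m) ξ η)
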